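{- Let $B,D$ be multiplicative characters of $\mathbb{F}_q^\times$ ($q$ odd) and set $C=D^2$. Assume $D\neq\phi$ and $B\neq D$. Then for $x\in\mathbb{F}_q$, $$\overline{C}(1-x)\,{}_2\mathbb{F}_1\!\left(D\phi\overline{B},D;C\overline{B};\tfrac{ -4x}{(1-x)^2}\right)={}_2\mathbb{F}_1(B,C;C\overline{B};x)-\delta(1-x)\frac{J(C,\overline{B}^2)}{J(C,\overline{B})}-\delta(1+x)\frac{J(\overline{B},D\phi)}{J(C,\overline{B})}.$$
   Context: Multiplicative characters of $\mathbb{F}_q^\times$ are extended to $\mathbb{F}_q$ by $\chi(0)=0$, including the trivial character. $\phi$ is the quadratic character, $\overline{A}=A^{ -1}$, products of characters are pointwise. $\delta(y)=1$ if $y=0$ and $0$ otherwise. $J(A,B)=\sum_{t\in\mathbb{F}_q}A(t)B(1-t)$. ${}_2\mathbb{P}_1(A,B;C;\lambda)=\sum_{y\in\mathbb{F}_q}B(y)\,\overline{B}C(1-y)\,\overline{A}(1-\lambda y)$ and ${}_2\mathbb{F}_1(A,B;C;\lambda)={}_2\mathbb{P}_1(A,B;C;\lambda)/J(B,\overline{B}C)$. When $x=1$ the argument on the left is undefined but its prefactor is $\overline{C}(0)=0$; the left side is then taken to be $0$. -}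

module Defs where

open import Data.Nat as ℕ using (ℕ; zero; suc; _%_)
open import Data.List using (List; []; _∷_; foldr; length)
open import Data.Bool.ListAction using (any)
open import Data.List.Membership.Propositional using (_∈_)
open import Data.List.Relation.Unary.Unique.Propositional using (Unique)
open import Data.Product using (∃)
open import Relation.Nullary using (¬_; does)
open import Relation.Binary.PropositionalEquality using (_≡_)
open import Relation.Binary.Definitions using (DecidableEquality)
open import Algebra.Structures using (IsCommutativeRing)
open import Data.Bool using (if_then_else_)

-- A field (propositional equality), with a TOTAL inverse: 0⁻¹ = 0.
-- (Only used at nonzero arguments in the statement, except at x = 1
-- where the prefactor C̄(0) = 0 kills the term, as the paper stipulates.)

record Field : Set₁ where
  infixl 6 _+_
  infixl 7 _*_
  infixl 6 _-_
  infix 8 -_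
  infix 9 _⁻¹
  field
    Carrier : Set
    _+_ _*_ : Carrier → Carrier → Carrier
    -_      : Carrier → Carrier
    0# 1#   : Carrier
    _⁻¹     : Carrier → Carrier
    isCommutativeRing : IsCommutativeRing _≡_ _+_ _*_ -_ 0# 1#
    0≢1     : ¬ (0# ≡ 1#)
    inverseʳ : ∀ x → ¬ (x ≡ 0#) → x * (x ⁻¹) ≡ 1#
    0⁻¹≡0   : 0# ⁻¹ ≡ 0#

  _-_ : Carrier → Carrier → Carrier
  x - y = x + (- y)

  fromℕ : ℕ → Carrier
  fromℕ zero    = 0#
  fromℕ (suc n) = 1# + fromℕ n

CharZero : Field → Set
CharZero K = ∀ n → ¬ (fromℕ (suc n) ≡ 0#)
  where open Field K

evalMonic : (K : Field) → List (Field.Carrier K) → Field.Carrier K → Field.Carrier K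
evalMonic K []       x = Field.1# K
evalMonic K (c ∷ cs) x = Field._+_ K c (Field._*_ K x (evalMonic K cs x))

AlgClosed : Field → Set
AlgClosed K = ∀ (c : Field.Carrier K) (cs : List (Field.Carrier K)) →
  ∃ λ r → evalMonic K (c ∷ cs) r ≡ Field.0# K

record FiniteField : Set₁ where
  field
    field′   : Field
  open Field field′ public
  field
    _≟_      : DecidableEquality Carrier
    elems    : List Carrier
    complete : ∀ x → x ∈ elems
    unique   : Unique elems

  card : ℕ
  card = length elems

-- Multiplicative characters of F_q^×, extended by χ(0) = 0, with values
-- in the field K (standing in for ℂ).

record MultChar (𝔽 : FiniteField) (K : Field) : Set where
  private
    module F = FiniteField 𝔽
    module K = Field K
  field
    χ    : F.Carrier → K.Carrier
    χ0   : χ F.0# ≡ K.0#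
    χ1   : χ F.1# ≡ K.1#
    χmul : ∀ x y → χ (x F.* y) ≡ χ x K.* χ y

module CharSums (𝔽 : FiniteField) (K : Field) where
  private
    module F = FiniteField 𝔽
    module K = Field K

  Fn : Set
  Fn = F.Carrier → K.Carrier

  _·_ : Fn → Fn → Fn
  (A · B) x = A x K.* B x

  conj : Fn → Fn
  conj A x = (A x) K.⁻¹

  Σ : Fn → K.Carrier
  Σ f = foldr (λ x acc → f x K.+ acc) K.0# F.elems

  δ : F.Carrier → K.Carrier
  δ y = if does (y F.≟ F.0#) then K.1# else K.0#

  isSquare : F.Carrier → Data.Bool.Bool
  isSquare x = any (λ y → does ((y F.* y) F.≟ x)) F.elems

  φ : Fn
  φ x = if does (x F.≟ F.0#) then K.0#
        else (if isSquare x then K.1# else K.- K.1#)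

  J : Fn → Fn → K.Carrier
  J A B = Σ (λ t → A t K.* B (F.1# F.- t))

  P21 : Fn → Fn → Fn → F.Carrier → K.Carrier
  P21 A B C l = Σ (λ y → B y K.* (conj B · C) (F.1# F.- y) K.* conj A (F.1# F.- l F.* y))

  F21 : Fn → Fn → Fn → F.Carrier → K.Carrier
  F21 A B C l = P21 A B C l K.* (J B (conj B · C)) K.⁻¹

{-# OPTIONS --safe #-}
-- Put A = D B̄. For x ≠ ±1 an Euler transformation turns the left-hand numerator into
-- S(x) = Σ_y A(y) D(1 - y) (φ D̄)((1 - x)² + 4 x y). Since r has 1 + φ(r) square roots,
-- (φ D̄)(r) is, up to a Jacobi sum κ and a constant, Σ_u D̄(u² - r). With u = 1 - x + 2 z,
--   u² - (1 - x)² - 4 x y = 4 (z (z + 1 - x) - x y),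
-- and replacing y by p = (z + y) / (1 - y) makes the sum over z a convolution of A and D̄. Summing
-- over p = 1/y - 1 gives κ S(x) = G P(x), where P is the right-hand numerator and G does not depend
-- on x; the case x = 0 then determines G / κ. At x = -1 the identity is one between Jacobi sums,
-- a consequence of their associativity.
--
-- Equality in K is not assumed decidable, so there is no case distinction on the triviality of a
-- character A; instead one computes with Σ A, which satisfies (Σ A) A(t) = Σ A for t ≠ 0.
module Submission where

open import Defs
open import Data.Nat using (_%_)
open import Relation.Nullary using (¬_)
open import Relation.Binary.PropositionalEquality using (_≡_)
open import Algebra.Bundles using (CommutativeRing)
open import Algebra.Solver.Ring.AlmostCommutativeRing using (_-Raw-AlmostCommutative⟶_; fromCommutativeRing)
open import Data.Bool as Bool using (true; false; if_then_else_)
open import Data.Bool.Properties using (T-≡)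
open import Data.Empty using (⊥; ⊥-elim)
open import Data.Integer as ℤ using (ℤ; -[1+_]) renaming (+_ to pos)
import Data.Integer.Properties as ℤ
open import Data.List using (List; []; _∷_; length; foldr)
open import Data.List.Membership.Propositional using (_∈_; _∉_; lose; find)
open import Data.List.Relation.Unary.All.Properties using (All¬⇒¬Any)
open import Data.List.Relation.Unary.AllPairs using (_∷_)
open import Data.List.Relation.Unary.Any using (here; there)
open import Data.List.Relation.Unary.Any.Properties using (any⁺; any⁻)
open import Data.List.Relation.Unary.Unique.Propositional using (Unique)
open import Data.Maybe using (Maybe; just; nothing)
open import Data.Nat as ℕ using (ℕ; zero; suc)
import Data.Nat.Properties as ℕ
open import Data.Product using (_×_; _,_; proj₁; proj₂; ∃)
open import Data.Unit using (tt)
open import Function.Bundles using (Equivalence)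
open import Relation.Binary.PropositionalEquality
  using (refl; sym; trans; cong; cong₂; subst; module ≡-Reasoning)
open import Relation.Nullary using (Dec; yes; no; does)
open import Relation.Nullary.Decidable using (dec-true; dec-false)

-- The argument l = -4x/(1-x)² satisfies 1 - l = ((1+x)/(1-x))². This is why x = -1 is exceptional:
-- there 1 - l = 0 and the Euler transformation degenerates, whereas for x ≠ ±1 a factor φ(1 - l)
-- equals 1 and drops out. The hypotheses D ≠ φ and B ≠ D enter only as the vanishing of the sums of
-- φD, φD̄ and D B̄. Either of B and D may still be trivial, so every identity carries correction
-- terms Σ D, Σ D̄ or Σ B̄ that vanish for nontrivial characters; most of the bookkeeping serves to
-- cancel them uniformly. Cancelling κ and dividing by J(D,A) and J(C,B̄) requires nonzero Jacobi
-- sums. K has no absolute value, so |J|² = q is replaced by a formula for J(A,B) J(Ā,B̄), and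
-- characteristic 0 together with q ≥ 3 keeps its values away from 0.

-- Field arithmetic, with a ring solver over integer coefficients

module FieldProperties (K : Field) where
  open Field K
  open ≡-Reasoning

  commutativeRing : CommutativeRing _ _
  commutativeRing = record { isCommutativeRing = isCommutativeRing }

  open CommutativeRing commutativeRing public
    using (+-comm; +-assoc; +-identityˡ; +-identityʳ; *-comm; *-assoc; *-identityˡ; *-identityʳ;
           zeroˡ; zeroʳ; distribˡ; -‿inverseˡ; -‿inverseʳ)
  private module R = CommutativeRing commutativeRing
  open import Algebra.Properties.Semiring.Mult.TCOptimised R.semiring
    using (×-homo-+; ×1-homo-*; 1+×) renaming (_×_ to _×′_)
  open import Algebra.Properties.Ring R.ring
    using (-‿distribˡ-*; -‿distribʳ-*; -0#≈0#; -‿involutive; -‿+-comm)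

  -- The multiple `_×′_` sends 1 to `1#` definitionally, so solver constants reduce to `0#` and `1#`
  -- and `refl` closes the normalised goals.
  fromℤ : ℤ → Carrier
  fromℤ (pos n)    = n ×′ 1#
  fromℤ -[1+ n ] = - (suc n ×′ 1#)

  fromℤ-neg : ∀ i → fromℤ (ℤ.- i) ≡ - fromℤ i
  fromℤ-neg (pos zero)  = sym -0#≈0#
  fromℤ-neg (pos (suc n)) = refl
  fromℤ-neg -[1+ n ]  = sym (-‿involutive _)

  fromℤ-⊖ : ∀ m n → fromℤ (m ℤ.⊖ n) ≡ m ×′ 1# - n ×′ 1#
  fromℤ-⊖ m zero = sym (trans (cong (λ z → m ×′ 1# + z) -0#≈0#) (+-identityʳ _))
  fromℤ-⊖ zero (suc n) = sym (+-identityˡ _)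
  fromℤ-⊖ (suc m) (suc n) = begin
    fromℤ (suc m ℤ.⊖ suc n)                ≡⟨ cong fromℤ (ℤ.[1+m]⊖[1+n]≡m⊖n m n) ⟩
    fromℤ (m ℤ.⊖ n)                        ≡⟨ fromℤ-⊖ m n ⟩
    M - N                                  ≡⟨ cong (_- N) (+-identityˡ M) ⟨
    0# + M - N                             ≡⟨ cong (λ z → z + M - N) (-‿inverseʳ 1#) ⟨
    1# - 1# + M - N                        ≡⟨ cong (_- N) (trans (+-assoc _ _ _) (cong (1# +_) (+-comm _ _))) ⟩
    1# + (M - 1#) - N                      ≡⟨ cong (_- N) (+-assoc _ _ _) ⟨
    1# + M - 1# - N                        ≡⟨ +-assoc _ _ _ ⟩
    1# + M + (- 1# - N)                    ≡⟨ cong (λ z → 1# + M + z) (-‿+-comm 1# N) ⟩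
    1# + M - (1# + N)                      ≡⟨ cong₂ _-_ (1+× m 1#) (1+× n 1#) ⟨
    suc m ×′ 1# - suc n ×′ 1#                ∎
    where M = m ×′ 1#
          N = n ×′ 1#

  fromℤ-+ : ∀ i j → fromℤ (i ℤ.+ j) ≡ fromℤ i + fromℤ j
  fromℤ-+ (pos m) (pos n)       = ×-homo-+ 1# m n
  fromℤ-+ (pos m) -[1+ n ]    = fromℤ-⊖ m (suc n)
  fromℤ-+ -[1+ m ] (pos n)    = trans (fromℤ-⊖ n (suc m)) (+-comm _ _)
  fromℤ-+ -[1+ m ] -[1+ n ] = begin
    - (suc (suc (m ℕ.+ n)) ×′ 1#)      ≡⟨ cong -_ (1+× (suc (m ℕ.+ n)) 1#) ⟩
    - (1# + suc (m ℕ.+ n) ×′ 1#)       ≡⟨ cong (λ z → - (1# + z)) (×-homo-+ 1# (suc m) n) ⟩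
    - (1# + (suc m ×′ 1# + n ×′ 1#))    ≡⟨ cong -_
        (trans (sym (+-assoc _ _ _)) (trans (cong (λ z → z + n ×′ 1#) (+-comm _ _)) (+-assoc _ _ _))) ⟩
    - (suc m ×′ 1# + (1# + n ×′ 1#))    ≡⟨ cong (λ z → - (suc m ×′ 1# + z)) (1+× n 1#) ⟨
    - (suc m ×′ 1# + suc n ×′ 1#)       ≡⟨ -‿+-comm _ _ ⟨
    - (suc m ×′ 1#) - suc n ×′ 1#       ∎

  fromℤ-* : ∀ i j → fromℤ (i ℤ.* j) ≡ fromℤ i * fromℤ j
  fromℤ-* (pos m) (pos n) = trans (cong fromℤ (ℤ.+◃n≡+n (m ℕ.* n))) (×1-homo-* m n)
  fromℤ-* (pos m) -[1+ n ] = trans (cong fromℤ (ℤ.-◃n≡-n (m ℕ.* suc n)))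
    (trans (fromℤ-neg (pos (m ℕ.* suc n))) (trans (cong -_ (×1-homo-* m (suc n))) (-‿distribʳ-* _ _)))
  fromℤ-* -[1+ m ] (pos n) = trans (cong fromℤ (ℤ.-◃n≡-n (suc m ℕ.* n)))
    (trans (fromℤ-neg (pos (suc m ℕ.* n))) (trans (cong -_ (×1-homo-* (suc m) n)) (-‿distribˡ-* _ _)))
  fromℤ-* -[1+ m ] -[1+ n ] = begin
    (suc m ℕ.* suc n) ×′ 1#         ≡⟨ ×1-homo-* (suc m) (suc n) ⟩
    M * N                          ≡⟨ -‿involutive _ ⟨
    - (- (M * N))                  ≡⟨ cong -_ (-‿distribʳ-* M N) ⟩
    - (M * - N)                    ≡⟨ -‿distribˡ-* M (- N) ⟩
    - M * - N                      ∎
    where M = suc m ×′ 1#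
          N = suc n ×′ 1#

  private
    ℤ⟶K : ℤ.+-*-rawRing -Raw-AlmostCommutative⟶ fromCommutativeRing commutativeRing
    ℤ⟶K = record
      { ⟦_⟧ = fromℤ ; +-homo = fromℤ-+ ; *-homo = fromℤ-* ; -‿homo = fromℤ-neg
      ; 0-homo = refl ; 1-homo = refl }

    _coeff≟_ : ∀ i j → Maybe (fromℤ i ≡ fromℤ j)
    i coeff≟ j with i ℤ.≟ j
    ... | yes eq = just (cong fromℤ eq)
    ... | no _   = nothing

  open import Algebra.Solver.Ring ℤ.+-*-rawRing (fromCommutativeRing commutativeRing) ℤ⟶K _coeff≟_ public
    using (solve; _:=_; _:+_; _:*_; _:-_; :-_; con; Polynomial)

  :0 :1 :2 :4 : ∀ {n} → Polynomial n
  :0 = con (pos 0)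
  :1 = con (pos 1)
  :2 = :1 :+ :1
  :4 = :2 :* :2

  2# 4# : Carrier
  2# = 1# + 1#
  4# = 2# * 2#

  fromℕ-4 : fromℕ 4 ≡ 4#
  fromℕ-4 = solve 0 (:1 :+ (:1 :+ (:1 :+ (:1 :+ :0))) := :4) refl

  1≢0 : ¬ (1# ≡ 0#)
  1≢0 e = 0≢1 (sym e)

  -- Reduces an equation holding modulo p ≡ q to a ring identity, c being the cofactor of p - q.
  mod : ∀ {x y p q} c → p ≡ q → x ≡ y + c * (p - q) → x ≡ y
  mod {x} {y} {p} {q} c refl e = trans e (solve 3 (λ y c p → y :+ c :* (p :- p) := y) refl y c p)

  -1≢0 : ¬ (- 1# ≡ 0#)
  -1≢0 e = 1≢0 (mod (- 1#) e (solve 0 (:1 := :0 :+ (:- :1) :* (:- :1 :- :0)) refl))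

  inverseˡ : ∀ {x} → ¬ (x ≡ 0#) → x ⁻¹ * x ≡ 1#
  inverseˡ {x} x≢0 = trans (*-comm _ _) (inverseʳ x x≢0)

  *-cancelˡ : ∀ {x y z} → ¬ (x ≡ 0#) → x * y ≡ x * z → y ≡ z
  *-cancelˡ {x} {y} {z} x≢0 e = begin
    y               ≡⟨ unit y ⟨
    x ⁻¹ * (x * y)  ≡⟨ cong (x ⁻¹ *_) e ⟩
    x ⁻¹ * (x * z)  ≡⟨ unit z ⟩
    z               ∎
    where
    unit : ∀ w → x ⁻¹ * (x * w) ≡ w
    unit w = trans (sym (*-assoc _ _ _)) (trans (cong (_* w) (inverseˡ x≢0)) (*-identityˡ w))

  zero-cancelˡ : ∀ {x y} → ¬ (x ≡ 0#) → x * y ≡ 0# → y ≡ 0#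
  zero-cancelˡ {x} x≢0 e = *-cancelˡ x≢0 (trans e (sym (zeroʳ x)))

  *-≢0 : ∀ {x y} → ¬ (x ≡ 0#) → ¬ (y ≡ 0#) → ¬ (x * y ≡ 0#)
  *-≢0 x≢0 y≢0 e = y≢0 (zero-cancelˡ x≢0 e)

  *≡1⇒≢0 : ∀ {x y} → x * y ≡ 1# → ¬ (x ≡ 0#)
  *≡1⇒≢0 {_} {y} e refl = 0≢1 (trans (sym (zeroˡ y)) e)

  ⁻¹-unique : ∀ {x y} → x * y ≡ 1# → x ⁻¹ ≡ y
  ⁻¹-unique {x} {y} e = *-cancelˡ (*≡1⇒≢0 e) (trans (inverseʳ x (*≡1⇒≢0 e)) (sym e))

  ⁻¹-≢0 : ∀ {x} → ¬ (x ≡ 0#) → ¬ (x ⁻¹ ≡ 0#)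
  ⁻¹-≢0 x≢0 = *≡1⇒≢0 (inverseˡ x≢0)

  1⁻¹ : 1# ⁻¹ ≡ 1#
  1⁻¹ = ⁻¹-unique (*-identityˡ 1#)

  x-y≡0⇒x≡y : ∀ {x y} → x - y ≡ 0# → x ≡ y
  x-y≡0⇒x≡y {x} {y} e = mod 1# e (solve 2 (λ x y → x := y :+ :1 :* (x :- y :- :0)) refl x y)

  /-unique : ∀ {x y z} → ¬ (y ≡ 0#) → x ≡ z * y → x * y ⁻¹ ≡ z
  /-unique {x} {y} {z} y≢0 e = begin
    x * y ⁻¹         ≡⟨ cong (_* y ⁻¹) e ⟩
    z * y * y ⁻¹     ≡⟨ *-assoc z y (y ⁻¹) ⟩
    z * (y * y ⁻¹)   ≡⟨ cong (z *_) (inverseʳ y y≢0) ⟩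
    z * 1#           ≡⟨ *-identityʳ z ⟩
    z                ∎

-- Sums over a finite field

module Sums (𝔽 : FiniteField) (K : Field) where
  private
    module F where
      open FiniteField 𝔽 public
      open FieldProperties field′ public
    module K where
      open Field K public
      open FieldProperties K public
  open K using (0#; 1#; _+_; _*_; _-_)
  open CharSums 𝔽 K using (Fn; Σ)
  open ≡-Reasoning

  if-yes : ∀ {A P : Set} (P? : Dec P) {x y : A} → P → (if does P? then x else y) ≡ x
  if-yes P? p rewrite dec-true P? p = refl

  if-no : ∀ {A P : Set} (P? : Dec P) {x y : A} → ¬ P → (if does P? then x else y) ≡ y
  if-no P? ¬p rewrite dec-false P? ¬p = refl

  private
    -- `Σ` over an arbitrary list, for induction; `Σ f` is definitionally `S F.elems f`.
    S : List F.Carrier → Fn → K.Carrier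
    S xs f = foldr (λ x acc → f x + acc) 0# xs

    S-cong : ∀ xs {f g : Fn} → (∀ x → f x ≡ g x) → S xs f ≡ S xs g
    S-cong []       e = refl
    S-cong (x ∷ xs) e = cong₂ _+_ (e x) (S-cong xs e)

    S-0 : ∀ xs → S xs (λ _ → 0#) ≡ 0#
    S-0 []       = refl
    S-0 (x ∷ xs) = trans (K.+-identityˡ _) (S-0 xs)

    S-+ : ∀ xs (f g : Fn) → S xs (λ x → f x + g x) ≡ S xs f + S xs g
    S-+ []       f g = sym (K.+-identityˡ _)
    S-+ (x ∷ xs) f g = trans (cong (f x + g x +_) (S-+ xs f g))
      (K.solve 4 (λ a b s t → a K.:+ b K.:+ (s K.:+ t) K.:= a K.:+ s K.:+ (b K.:+ t)) refl (f x) (g x) (S xs f) (S xs g))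

    S-* : ∀ xs c (f : Fn) → S xs (λ x → c * f x) ≡ c * S xs f
    S-* []       c f = sym (K.zeroʳ c)
    S-* (x ∷ xs) c f = trans (cong (c * f x +_) (S-* xs c f)) (sym (K.distribˡ c _ _))

    S-swap : ∀ xs ys (f : F.Carrier → Fn) → S xs (λ x → S ys (f x)) ≡ S ys (λ y → S xs (λ x → f x y))
    S-swap []       ys f = sym (S-0 ys)
    S-swap (x ∷ xs) ys f = trans (cong (S ys (f x) +_) (S-swap xs ys f)) (sym (S-+ ys _ _))

    S-∉ : ∀ xs {a} (g : Fn) → a ∉ xs → S xs (λ x → if does (x F.≟ a) then g x else 0#) ≡ 0#
    S-∉ [] g a∉ = refl
    S-∉ (x ∷ xs) {a} g a∉ = trans (cong₂ _+_ (if-no (x F.≟ a) (λ e → a∉ (here (sym e))))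
        (S-∉ xs g (λ p → a∉ (there p)))) (K.+-identityˡ _)

    S-∈ : ∀ {xs a} (g : Fn) → Unique xs → a ∈ xs → S xs (λ x → if does (x F.≟ a) then g x else 0#) ≡ g a
    S-∈ {x ∷ xs} g (x∉ ∷ _) (here refl) =
      trans (cong₂ _+_ (if-yes (x F.≟ x) refl) (S-∉ xs g (All¬⇒¬Any x∉))) (K.+-identityʳ _)
    S-∈ {x ∷ xs} {a} g (x∉ ∷ u) (there a∈) =
      trans (cong₂ _+_ (if-no (x F.≟ a) (λ { refl → All¬⇒¬Any x∉ a∈ })) (S-∈ g u a∈)) (K.+-identityˡ _)

    S-const : ∀ xs → S xs (λ _ → 1#) ≡ K.fromℕ (length xs)
    S-const []       = refl
    S-const (x ∷ xs) = cong (1# +_) (S-const xs)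

  Σ-cong : ∀ {f g : Fn} → (∀ x → f x ≡ g x) → Σ f ≡ Σ g
  Σ-cong = S-cong F.elems

  Σ-0 : ∀ {f : Fn} → (∀ x → f x ≡ 0#) → Σ f ≡ 0#
  Σ-0 e = trans (Σ-cong e) (S-0 F.elems)

  Σ-+ : ∀ (f g : Fn) → Σ (λ x → f x + g x) ≡ Σ f + Σ g
  Σ-+ = S-+ F.elems

  Σ-*ˡ : ∀ c (f : Fn) → Σ (λ x → c * f x) ≡ c * Σ f
  Σ-*ˡ = S-* F.elems

  Σ-*ʳ : ∀ c (f : Fn) → Σ (λ x → f x * c) ≡ Σ f * c
  Σ-*ʳ c f = trans (Σ-cong (λ x → K.*-comm (f x) c)) (trans (Σ-*ˡ c f) (K.*-comm c _))

  Σ-swap : ∀ (f : F.Carrier → Fn) → Σ (λ x → Σ (f x)) ≡ Σ (λ y → Σ (λ x → f x y))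
  Σ-swap = S-swap F.elems F.elems

  -- The only place where uniqueness of the enumeration enters; every change of variables rests on
  -- it.
  Σ-single : ∀ a (g : Fn) → Σ (λ x → if does (x F.≟ a) then g x else 0#) ≡ g a
  Σ-single a g = S-∈ g F.unique (F.complete a)

  Σ-1 : Σ (λ _ → 1#) ≡ K.fromℕ F.card
  Σ-1 = S-const F.elems

  -- Adding to each function the value of the other one at `a`, as a delta function, makes the
  -- summands agree everywhere.
  Σ-except : ∀ a {f g : Fn} → (∀ x → ¬ (x ≡ a) → f x ≡ g x) → Σ f + g a ≡ Σ g + f a
  Σ-except a {f} {g} e = begin
    Σ f + g a                       ≡⟨ cong (Σ f +_) (Σ-single a g) ⟨
    Σ f + Σ (at g)                  ≡⟨ Σ-+ f (at g) ⟨
    Σ (λ x → f x + at g x)          ≡⟨ Σ-cong pointwise ⟩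
    Σ (λ x → g x + at f x)          ≡⟨ Σ-+ g (at f) ⟩
    Σ g + Σ (at f)                  ≡⟨ cong (Σ g +_) (Σ-single a f) ⟩
    Σ g + f a                       ∎
    where
    at : Fn → Fn
    at h x = if does (x F.≟ a) then h x else 0#
    pointwise : ∀ x → f x + at g x ≡ g x + at f x
    pointwise x with x F.≟ a
    ... | yes _  = K.+-comm _ _
    ... | no x≢a = cong (_+ 0#) (e x x≢a)

  Σ-change : ∀ a {f g : Fn} → (∀ x → ¬ (x ≡ a) → f x ≡ g x) → Σ f ≡ Σ g - g a + f a
  Σ-change a {f} {g} e = K.mod 1# (Σ-except a e)
    (K.solve 4 (λ s g t f → s K.:= t K.:- g K.:+ f K.:+ K.:1 K.:* (s K.:+ g K.:- (t K.:+ f))) refl (Σ f) (g a) (Σ g) (f a))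

  -- A change of variables σ which is a bijection from {u ≢ 0} onto {v ≢ 0} with inverse τ.
  Σ-reindex : ∀ (u v σ τ : F.Carrier → F.Carrier) {f g : Fn} →
    (∀ x → u x ≡ F.0# → f x ≡ 0#) →
    (∀ y → v y ≡ F.0# → g y ≡ 0#) →
    (∀ x → ¬ (u x ≡ F.0#) → ¬ (v (σ x) ≡ F.0#) × τ (σ x) ≡ x × f x ≡ g (σ x)) →
    (∀ y → ¬ (v y ≡ F.0#) → ¬ (u (τ y) ≡ F.0#) × σ (τ y) ≡ y) →
    Σ f ≡ Σ g
  Σ-reindex u v σ τ {f} {g} f0 g0 toʳ toˡ = begin
    Σ f                            ≡⟨ Σ-cong row ⟩
    Σ (λ x → Σ (k x))              ≡⟨ Σ-swap k ⟩
    Σ (λ y → Σ (λ x → k x y))      ≡⟨ Σ-cong col ⟩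
    Σ g                            ∎
    where
    -- The graph of σ over {u ≢ 0}, weighted by `g`: its row sums are `f` and its column sums are
    -- `g`.
    k : F.Carrier → Fn
    k x y = if does (u x F.≟ F.0#) then 0# else (if does (y F.≟ σ x) then g y else 0#)
    row : ∀ x → f x ≡ Σ (k x)
    row x with u x F.≟ F.0#
    ... | yes ux≡0 = trans (f0 x ux≡0) (sym (Σ-0 (λ _ → refl)))
    ... | no ux≢0  = trans (proj₂ (proj₂ (toʳ x ux≢0))) (sym (Σ-single (σ x) g))
    col : ∀ y → Σ (λ x → k x y) ≡ g y
    col y with v y F.≟ F.0#
    ... | yes vy≡0 = trans (Σ-0 vanish) (sym (g0 y vy≡0))
      where
      vanish : ∀ x → k x y ≡ 0#
      vanish x with u x F.≟ F.0# | y F.≟ σ x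
      ... | yes _ | _     = refl
      ... | no _  | yes _ = g0 y vy≡0
      ... | no _  | no _  = refl
    ... | no vy≢0 = trans (Σ-cong collect) (Σ-single (τ y) (λ _ → g y))
      where
      collect : ∀ x → k x y ≡ (if does (x F.≟ τ y) then g y else 0#)
      collect x with u x F.≟ F.0# | y F.≟ σ x | x F.≟ τ y
      ... | yes ux≡0 | _      | yes refl = ⊥-elim (proj₁ (toˡ y vy≢0) ux≡0)
      ... | yes ux≡0 | _      | no _     = refl
      ... | no ux≢0  | yes refl | yes _  = refl
      ... | no ux≢0  | yes refl | no x≢  = ⊥-elim (x≢ (sym (proj₁ (proj₂ (toʳ x ux≢0)))))
      ... | no ux≢0  | no y≢  | yes refl = ⊥-elim (y≢ (sym (proj₂ (toˡ y vy≢0))))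
      ... | no ux≢0  | no y≢  | no _     = refl

  Σ-bijection : ∀ (σ τ : F.Carrier → F.Carrier) (f : Fn) →
    (∀ x → τ (σ x) ≡ x) → (∀ y → σ (τ y) ≡ y) → Σ (λ x → f (σ x)) ≡ Σ f
  Σ-bijection σ τ f τσ στ = Σ-reindex (λ _ → F.1#) (λ _ → F.1#) σ τ
    (λ _ e → ⊥-elim (F.1≢0 e)) (λ _ e → ⊥-elim (F.1≢0 e))
    (λ x _ → F.1≢0 , τσ x , refl) (λ y _ → F.1≢0 , στ y)

  Σ-translate : ∀ r (f : Fn) → Σ (λ x → f (x F.+ r)) ≡ Σ f
  Σ-translate r f = Σ-bijection (F._+ r) (F._- r) f
    (λ x → F.solve 2 (λ x r → x F.:+ r F.:- r F.:= x) refl x r)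
    (λ x → F.solve 2 (λ x r → x F.:- r F.:+ r F.:= x) refl x r)

  Σ-reflect : ∀ r (f : Fn) → Σ (λ x → f (r F.- x)) ≡ Σ f
  Σ-reflect r f = Σ-bijection (λ x → r F.- x) (λ x → r F.- x) f invol invol
    where invol = λ x → F.solve 2 (λ x r → r F.:- (r F.:- x) F.:= x) refl x r

  Σ-scale : ∀ {r} → ¬ (r ≡ F.0#) → (f : Fn) → Σ (λ x → f (r F.* x)) ≡ Σ f
  Σ-scale {r} r≢0 f = Σ-bijection (r F.*_) (r F.⁻¹ F.*_) f
    (λ x → cancel (F.inverseˡ r≢0)) (λ x → cancel (F.inverseʳ r r≢0))
    where
    cancel : ∀ {r s x} → r F.* s ≡ F.1# → r F.* (s F.* x) ≡ x
    cancel {r} {s} {x} e = trans (sym (F.*-assoc r s x)) (trans (cong (F._* x) e) (F.*-identityˡ x))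

-- Multiplicative characters

module OddOrder (𝔽 : FiniteField) (odd : FiniteField.card 𝔽 % 2 ≡ 1) where
  open FiniteField 𝔽
  open FieldProperties field′
  open Sums 𝔽 field′
  open CharSums 𝔽 field′ using (Σ)

  -- Translating by 1 permutes the field, so the sum of its elements shows that card · 1 vanishes.
  fromℕ-card : fromℕ card ≡ 0#
  fromℕ-card = trans (sym Σ-1) (mod 1# (trans (sym (Σ-+ (λ x → x) (λ _ → 1#))) (Σ-translate 1# (λ x → x)))
    (solve 2 (λ s c → c := :0 :+ :1 :* (s :+ c :- s)) refl (Σ (λ x → x)) (Σ (λ _ → 1#))))

  -- If 2 vanished, `fromℕ` would depend only on parity, and `fromℕ card` would be 1 instead of 0.
  2≢0 : ¬ (2# ≡ 0#)
  2≢0 2≡0 = 0≢1 (trans (sym fromℕ-card) (fromℕ-odd card odd))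
    where
    fromℕ-odd : ∀ n → n % 2 ≡ 1 → fromℕ n ≡ 1#
    fromℕ-odd (suc zero)    _ = +-identityʳ 1#
    fromℕ-odd (suc (suc n)) e = mod 1# 2≡0 (trans (cong (λ z → 1# + (1# + z)) (fromℕ-odd n e))
      (solve 0 (:1 :+ (:1 :+ :1) := :1 :+ :1 :* (:2 :- :0)) refl))

  4≢0 : ¬ (4# ≡ 0#)
  4≢0 = *-≢0 2≢0 2≢0

  -- Oddness leaves only 1 to be excluded, which 0 ≠ 1 does. The bound makes q, q - 1 and q - 2
  -- nonzero in `K`.
  card≥3 : ∃ λ m → card ≡ 3 ℕ.+ m
  card≥3 = go elems odd (complete 0#) (complete 1#)
    where
    go : ∀ xs → length xs % 2 ≡ 1 → 0# ∈ xs → 1# ∈ xs → ∃ λ m → length xs ≡ 3 ℕ.+ m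
    go (_ ∷ [])         _ (here e) (here e′) = ⊥-elim (0≢1 (trans e (sym e′)))
    go (_ ∷ _ ∷ _ ∷ xs) _ _        _         = length xs , refl

module CharacterSums (𝔽 : FiniteField) (K : Field) (char0 : CharZero K) (odd : FiniteField.card 𝔽 % 2 ≡ 1) where
  private
    module F where
      open FiniteField 𝔽 public
      open FieldProperties field′ public
      open OddOrder 𝔽 odd public
    module K where
      open Field K public
      open FieldProperties K public
  open K using (0#; 1#; _+_; _*_; -_; _-_; _⁻¹; solve; _:=_; _:+_; _:*_; _:-_; :-_; :0; :1; :2; :4)
  open CharSums 𝔽 K
  open Sums 𝔽 K
  open MultChar
  open ≡-Reasoning

  Character : Set
  Character = MultChar 𝔽 K

  q : K.Carrier
  q = Σ (λ _ → 1#)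

  private
    q≡ : ∃ λ m → q ≡ K.fromℕ (3 ℕ.+ m)
    q≡ = proj₁ F.card≥3 , trans Σ-1 (cong K.fromℕ (proj₂ F.card≥3))

  q≢0 : ¬ (q ≡ 0#)
  q≢0 e = char0 (2 ℕ.+ proj₁ q≡) (trans (sym (proj₂ q≡)) e)

  q-1≢0 : ¬ (q - 1# ≡ 0#)
  q-1≢0 e = char0 (suc (proj₁ q≡)) (trans (K.mod (- 1#) (proj₂ q≡)
    (solve 2 (λ n q → n := q :- :1 :+ (:- :1) :* (q :- (:1 :+ n))) refl (K.fromℕ (2 ℕ.+ proj₁ q≡)) q)) e)

  q-2≢0 : ¬ (q - K.2# ≡ 0#)
  q-2≢0 e = char0 (proj₁ q≡) (trans (K.mod (- 1#) (proj₂ q≡)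
    (solve 2 (λ n q → n := q :- :2 :+ (:- :1) :* (q :- (:1 :+ (:1 :+ n)))) refl (K.fromℕ (1 ℕ.+ proj₁ q≡)) q)) e)

  χ-inverseʳ : ∀ (A : Character) {x} → ¬ (x ≡ F.0#) → χ A x * χ A (x F.⁻¹) ≡ 1#
  χ-inverseʳ A {x} x≢0 = trans (sym (χmul A x (x F.⁻¹))) (trans (cong (χ A) (F.inverseʳ x x≢0)) (χ1 A))

  χ-≢0 : ∀ (A : Character) {x} → ¬ (x ≡ F.0#) → ¬ (χ A x ≡ 0#)
  χ-≢0 A x≢0 = K.*≡1⇒≢0 (χ-inverseʳ A x≢0)

  χ-⁻¹ : ∀ (A : Character) x → χ A (x F.⁻¹) ≡ (χ A x) ⁻¹
  χ-⁻¹ A x with x F.≟ F.0#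
  ... | yes refl = trans (cong (χ A) F.0⁻¹≡0) (trans (χ0 A) (trans (sym K.0⁻¹≡0) (cong _⁻¹ (sym (χ0 A)))))
  ... | no x≢0   = sym (K.⁻¹-unique (χ-inverseʳ A x≢0))

  χ-ext : ∀ (A B : Character) → (∀ x → ¬ (x ≡ F.0#) → χ A x ≡ χ B x) → ∀ x → χ A x ≡ χ B x
  χ-ext A B e x = by-case (x F.≟ F.0#)
    where
    by-case : Dec (x ≡ F.0#) → χ A x ≡ χ B x
    by-case (yes refl) = trans (χ0 A) (sym (χ0 B))
    by-case (no x≢0)   = e x x≢0

  infixl 7 _⊗_
  _⊗_ : Character → Character → Character
  A ⊗ B = record
    { χ    = χ A · χ B
    ; χ0   = trans (cong (_* χ B F.0#) (χ0 A)) (K.zeroˡ _)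
    ; χ1   = trans (cong₂ _*_ (χ1 A) (χ1 B)) (K.*-identityˡ 1#)
    ; χmul = λ x y → trans (cong₂ _*_ (χmul A x y) (χmul B x y))
        (solve 4 (λ a b c d → a :* b :* (c :* d) := a :* c :* (b :* d)) refl (χ A x) (χ A y) (χ B x) (χ B y))
    }

  infix 8 _⁻
  _⁻ : Character → Character
  A ⁻ = record
    { χ    = conj (χ A)
    ; χ0   = trans (cong _⁻¹ (χ0 A)) K.0⁻¹≡0
    ; χ1   = trans (cong _⁻¹ (χ1 A)) K.1⁻¹
    ; χmul = mul
    }
    where
    mul : ∀ x y → χ A (x F.* y) ⁻¹ ≡ χ A x ⁻¹ * χ A y ⁻¹
    mul x y with x F.≟ F.0# | y F.≟ F.0#
    ... | yes refl | _ = trans (cong (λ z → χ A z ⁻¹) (F.zeroˡ y))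
        (trans A0⁻¹ (sym (trans (cong (_* χ A y ⁻¹) A0⁻¹) (K.zeroˡ _))))
      where A0⁻¹ = trans (cong _⁻¹ (χ0 A)) K.0⁻¹≡0
    ... | no _ | yes refl = trans (cong (λ z → χ A z ⁻¹) (F.zeroʳ x))
        (trans A0⁻¹ (sym (trans (cong (χ A x ⁻¹ *_) A0⁻¹) (K.zeroʳ _))))
      where A0⁻¹ = trans (cong _⁻¹ (χ0 A)) K.0⁻¹≡0
    ... | no x≢0 | no y≢0 = K.⁻¹-unique (begin
      χ A (x F.* y) * (χ A x ⁻¹ * χ A y ⁻¹)          ≡⟨ cong (_* (χ A x ⁻¹ * χ A y ⁻¹)) (χmul A x y) ⟩
      χ A x * χ A y * (χ A x ⁻¹ * χ A y ⁻¹)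
        ≡⟨ solve 4 (λ a b c d → a :* b :* (c :* d) := a :* c :* (b :* d)) refl (χ A x) (χ A y) (χ A x ⁻¹) (χ A y ⁻¹) ⟩
      χ A x * χ A x ⁻¹ * (χ A y * χ A y ⁻¹)
        ≡⟨ cong₂ _*_ (K.inverseʳ _ (χ-≢0 A x≢0)) (K.inverseʳ _ (χ-≢0 A y≢0)) ⟩
      1# * 1#                                         ≡⟨ K.*-identityˡ 1# ⟩
      1#                                              ∎)

  χ-⁻ʳ : ∀ (A : Character) {x} → ¬ (x ≡ F.0#) → χ A x * χ (A ⁻) x ≡ 1#
  χ-⁻ʳ A x≢0 = K.inverseʳ _ (χ-≢0 A x≢0)

  Σ-χχ⁻ : ∀ (A : Character) → Σ (χ (A ⊗ A ⁻)) ≡ q - 1#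
  Σ-χχ⁻ A = trans (Σ-change F.0# (λ x x≢0 → χ-⁻ʳ A x≢0)) (trans (cong (q - 1# +_) (χ0 (A ⊗ A ⁻))) (K.+-identityʳ _))

  absorb : ∀ (A : Character) {t} → ¬ (t ≡ F.0#) → Σ (χ A) * χ A t ≡ Σ (χ A)
  absorb A {t} t≢0 = begin
    Σ (χ A) * χ A t              ≡⟨ K.*-comm _ _ ⟩
    χ A t * Σ (χ A)              ≡⟨ Σ-*ˡ (χ A t) (χ A) ⟨
    Σ (λ x → χ A t * χ A x)      ≡⟨ Σ-cong (λ x → sym (χmul A t x)) ⟩
    Σ (λ x → χ A (t F.* x))      ≡⟨ Σ-scale t≢0 (χ A) ⟩
    Σ (χ A)                      ∎

  -- `absorb` says nothing at the zeros of `h`, so `f` itself has to vanish there.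
  absorb-Σ : ∀ (A : Character) (h : F.Carrier → F.Carrier) {f : Fn} → (∀ t → h t ≡ F.0# → f t ≡ 0#) →
    Σ (χ A) * Σ (λ t → χ A (h t) * f t) ≡ Σ (χ A) * Σ f
  absorb-Σ A h {f} f0 = begin
    Σ (χ A) * Σ (λ t → χ A (h t) * f t)      ≡⟨ Σ-*ˡ _ _ ⟨
    Σ (λ t → Σ (χ A) * (χ A (h t) * f t))    ≡⟨ Σ-cong pointwise ⟩
    Σ (λ t → Σ (χ A) * f t)                  ≡⟨ Σ-*ˡ _ _ ⟩
    Σ (χ A) * Σ f                            ∎
    where
    pointwise : ∀ t → Σ (χ A) * (χ A (h t) * f t) ≡ Σ (χ A) * f t
    pointwise t with h t F.≟ F.0#
    ... | yes h≡0 = cong (Σ (χ A) *_) (trans (cong (χ A (h t) *_) (f0 t h≡0)) (trans (K.zeroʳ _) (sym (f0 t h≡0))))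
    ... | no h≢0  = trans (sym (K.*-assoc _ _ _)) (cong (_* f t) (absorb A h≢0))

  -- Covers two cases at once: for nontrivial A both sides vanish, and for trivial A the product A B
  -- is B.
  Σχ*Σχ : ∀ (A B : Character) → Σ (χ A) * Σ (χ (A ⊗ B)) ≡ Σ (χ A) * Σ (χ B)
  Σχ*Σχ A B = absorb-Σ A (λ t → t) (λ { t refl → χ0 B })

  -- This is `Σχ*Σχ` with the trivial character A Ā in the second place: it leaves A unchanged and
  -- has sum q - 1.
  Σχ-idempotent : ∀ (A : Character) → Σ (χ A) * (Σ (χ A) - (q - 1#)) ≡ 0#
  Σχ-idempotent A = K.mod 1# SS≡S[q-1]
    (solve 2 (λ s r → s :* (s :- r) := :0 :+ :1 :* (s :* s :- s :* r)) refl (Σ (χ A)) (q - 1#))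
    where
    AA⁻A≡A : ∀ x → χ (A ⊗ (A ⊗ A ⁻)) x ≡ χ A x
    AA⁻A≡A = χ-ext (A ⊗ (A ⊗ A ⁻)) A (λ x x≢0 → trans (cong (χ A x *_) (χ-⁻ʳ A x≢0)) (K.*-identityʳ _))
    SS≡S[q-1] : Σ (χ A) * Σ (χ A) ≡ Σ (χ A) * (q - 1#)
    SS≡S[q-1] = begin
      Σ (χ A) * Σ (χ A)                   ≡⟨ cong (Σ (χ A) *_) (Σ-cong AA⁻A≡A) ⟨
      Σ (χ A) * Σ (χ (A ⊗ (A ⊗ A ⁻)))     ≡⟨ Σχ*Σχ A (A ⊗ A ⁻) ⟩
      Σ (χ A) * Σ (χ (A ⊗ A ⁻))           ≡⟨ cong (Σ (χ A) *_) (Σ-χχ⁻ A) ⟩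
      Σ (χ A) * (q - 1#)                  ∎

  Σχ≢0⇒≡q-1 : ∀ (A : Character) → ¬ (Σ (χ A) ≡ 0#) → Σ (χ A) ≡ q - 1#
  Σχ≢0⇒≡q-1 A S≢0 = K.x-y≡0⇒x≡y (K.zero-cancelˡ S≢0 (Σχ-idempotent A))

  -- S = Σ χ satisfies S (S - (q - 1)) = 0, so it vanishes as soon as S - (q - 1) is not zero.
  nontrivial⇒Σχ≡0 : ∀ (A : Character) → ¬ (∀ x → ¬ (x ≡ F.0#) → χ A x ≡ 1#) → Σ (χ A) ≡ 0#
  nontrivial⇒Σχ≡0 A nontrivial = K.zero-cancelˡ S-[q-1]≢0 (trans (K.*-comm _ _) (Σχ-idempotent A))
    where
    -- A double negation is all that is available without deciding S = 0, and it suffices to refute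
    -- S = q - 1.
    S≡0-stable : ¬ ¬ (Σ (χ A) ≡ 0#)
    S≡0-stable S≢0 = nontrivial (λ x x≢0 → K.*-cancelˡ S≢0 (trans (absorb A x≢0) (sym (K.*-identityʳ _))))
    S-[q-1]≢0 : ¬ (Σ (χ A) - (q - 1#) ≡ 0#)
    S-[q-1]≢0 e = S≡0-stable (λ S≡0 → q-1≢0 (trans (sym (K.x-y≡0⇒x≡y e)) S≡0))

  -- The quadratic character

  T-does : ∀ {P : Set} (P? : Dec P) → P → Bool.T (does P?)
  T-does (yes _) _ = tt
  T-does (no ¬p) p = ⊥-elim (¬p p)

  T-does⁻¹ : ∀ {P : Set} (P? : Dec P) → Bool.T (does P?) → P
  T-does⁻¹ (yes p) _ = p

  -- A view pairing the value of `φ` with a square root or a proof that there is none, so that the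
  -- Boolean search in `isSquare` is analysed only once.
  data Quadratic (x : F.Carrier) : Set where
    zero      : x ≡ F.0# → φ x ≡ 0# → Quadratic x
    square    : ∀ r → ¬ (r ≡ F.0#) → x ≡ r F.* r → φ x ≡ 1# → Quadratic x
    nonsquare : (∀ r → ¬ (r F.* r ≡ x)) → φ x ≡ - 1# → Quadratic x

  φ0 : φ F.0# ≡ 0#
  φ0 = if-yes (F.0# F.≟ F.0#) refl

  φ-square : ∀ {r} → ¬ (r ≡ F.0#) → φ (r F.* r) ≡ 1#
  φ-square {r} r≢0 = trans (if-no ((r F.* r) F.≟ F.0#) (F.*-≢0 r≢0 r≢0)) (cong (if_then 1# else - 1#)
    (Equivalence.to T-≡ (any⁺ _ (lose (F.complete r) (T-does ((r F.* r) F.≟ (r F.* r)) refl)))))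

  quadratic : ∀ x → Quadratic x
  quadratic x with x F.≟ F.0#
  ... | yes refl = zero refl φ0
  ... | no x≢0 with isSquare x in eq
  ...   | true with find (any⁻ (λ y → does ((y F.* y) F.≟ x)) F.elems (Equivalence.from T-≡ eq))
  ...     | r , _ , r²≟x with T-does⁻¹ ((r F.* r) F.≟ x) r²≟x
  ...       | refl = square r r≢0 refl (φ-square r≢0)
    where
    r≢0 : ¬ (r ≡ F.0#)
    r≢0 refl = x≢0 (F.zeroˡ F.0#)
  quadratic x | no x≢0 | false = nonsquare not-square
    (trans (if-no (x F.≟ F.0#) x≢0) (cong (if_then 1# else - 1#) eq))
    where
    not-square : ∀ r → ¬ (r F.* r ≡ x)
    not-square r r²≡x with () ← trans (sym eq) (Equivalence.to T-≡
      (any⁺ _ (lose (F.complete r) (T-does ((r F.* r) F.≟ x) r²≡x))))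

  nonsquare-≢0 : ∀ {g} → (∀ r → ¬ (r F.* r ≡ g)) → ¬ (g ≡ F.0#)
  nonsquare-≢0 g-non refl = g-non F.0# (F.zeroˡ F.0#)

  Σ-square : ∀ (f : Fn) → Σ (λ u → f (u F.* u)) ≡ Σ f + Σ (φ · f)
  Σ-square f = begin
    Σ (λ u → f (u F.* u))          ≡⟨ Σ-cong (λ u → sym (Σ-single (u F.* u) f)) ⟩
    Σ (λ u → Σ (λ s → k u s))      ≡⟨ Σ-swap k ⟩
    Σ (λ s → Σ (λ u → k u s))      ≡⟨ Σ-cong col ⟩
    Σ (λ s → f s + φ s * f s)      ≡⟨ Σ-+ f (φ · f) ⟩
    Σ f + Σ (φ · f)                ∎
    where
    k : F.Carrier → Fn
    k u s = if does (s F.≟ (u F.* u)) then f s else 0#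
    root : ∀ s r u → K.Carrier
    root s r u = if does (u F.≟ r) then f s else 0#
    col : ∀ s → Σ (λ u → k u s) ≡ f s + φ s * f s
    col s with quadratic s
    ... | nonsquare s-non φs = trans (Σ-0 (λ u → if-no (s F.≟ (u F.* u)) (λ e → s-non u (sym e))))
      (trans (solve 1 (λ a → :0 := a :+ (:- :1) :* a) refl (f s)) (cong (λ z → f s + z * f s) (sym φs)))
    ... | zero refl φs = trans (Σ-cong roots) (trans (Σ-single s (λ _ → f s))
      (trans (solve 1 (λ a → a := a :+ :0 :* a) refl (f s)) (cong (λ z → f s + z * f s) (sym φs))))
      where
      roots : ∀ u → k u F.0# ≡ root F.0# F.0# u
      roots u with u F.≟ F.0#
      ... | yes refl = if-yes (F.0# F.≟ (F.0# F.* F.0#)) (sym (F.zeroˡ F.0#))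
      ... | no u≢0   = if-no (F.0# F.≟ (u F.* u)) (λ e → F.*-≢0 u≢0 u≢0 (sym e))
    ... | square r r≢0 refl φs = begin
      Σ (λ u → k u s)                        ≡⟨ Σ-cong roots ⟩
      Σ (λ u → root s r u + root s (F.- r) u)
        ≡⟨ Σ-+ (root s r) (root s (F.- r)) ⟩
      Σ (root s r) + Σ (root s (F.- r))
        ≡⟨ cong₂ _+_ (Σ-single r (λ _ → f s)) (Σ-single (F.- r) (λ _ → f s)) ⟩
      f s + f s
        ≡⟨ solve 1 (λ a → a :+ a := a :+ :1 :* a) refl (f s) ⟩
      f s + 1# * f s                         ≡⟨ cong (λ z → f s + z * f s) φs ⟨
      f s + φ s * f s                        ∎
      where
      -- Odd characteristic makes the two roots distinct; otherwise the two delta functions would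
      -- count one root twice.
      r≢-r : ¬ (r ≡ F.- r)
      r≢-r e = F.*-≢0 F.2≢0 r≢0 (F.mod F.1# e
        (F.solve 1 (λ r → F.:2 F.:* r F.:= F.:0 F.:+ F.:1 F.:* (r F.:- (F.:- r))) refl r))
      roots : ∀ u → k u (r F.* r) ≡ root (r F.* r) r u + root (r F.* r) (F.- r) u
      roots u with u F.≟ r | u F.≟ (F.- r)
      ... | yes refl | yes u≡-u = ⊥-elim (r≢-r u≡-u)
      ... | yes refl | no _ = trans (if-yes ((u F.* u) F.≟ (u F.* u)) refl) (sym (K.+-identityʳ _))
      ... | no _ | yes refl = trans (if-yes ((r F.* r) F.≟ (F.- r F.* F.- r))
        (F.solve 1 (λ r → r F.:* r F.:= F.:- r F.:* F.:- r) refl r)) (sym (K.+-identityˡ _))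
      ... | no u≢r | no u≢-r = trans (if-no ((r F.* r) F.≟ (u F.* u)) (λ e →
        F.*-≢0 (λ e₁ → u≢r (F.x-y≡0⇒x≡y e₁)) (λ e₂ → u≢-r (F.x-y≡0⇒x≡y e₂))
          (F.mod (F.- F.1#) e (F.solve 2 (λ u r → (u F.:- r) F.:* (u F.:- (F.:- r)) F.:=
            F.:0 F.:+ (F.:- F.:1) F.:* (r F.:* r F.:- u F.:* u)) refl u r))))
        (sym (K.+-identityˡ _))

  -- `Σ-square` for the constant function 1: the sum over u and the sum over s are both q.
  Σφ≡0 : Σ φ ≡ 0#
  Σφ≡0 = K.mod (- 1#) (Σ-square (λ _ → 1#)) (trans (solve 2 (λ a b → b := :0 :+ (:- :1) :* (a :- (a :+ b))) refl q (Σ φ))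
    (cong (λ z → 0# + (- 1#) * (q - (q + z))) (Σ-cong (λ x → sym (K.*-identityʳ (φ x))))))

  φ-scale : ∀ {r} → ¬ (r ≡ F.0#) → ∀ x → φ (r F.* r F.* x) ≡ φ x
  φ-scale {r} r≢0 x with quadratic x
  ... | zero refl φx = cong φ (F.zeroʳ _)
  ... | square s s≢0 refl φx = trans (cong φ
      (F.solve 2 (λ r s → r F.:* r F.:* (s F.:* s) F.:= r F.:* s F.:* (r F.:* s)) refl r s))
    (trans (φ-square (F.*-≢0 r≢0 s≢0)) (sym φx))
  ... | nonsquare x-non φx with quadratic (r F.* r F.* x)
  ...   | zero e _ = ⊥-elim (F.*-≢0 (F.*-≢0 r≢0 r≢0) (nonsquare-≢0 x-non) e)
  ...   | nonsquare _ φrrx = trans φrrx (sym φx)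
  ...   | square s s≢0 e _ = ⊥-elim (x-non (r F.⁻¹ F.* s) (begin
    i F.* s F.* (i F.* s)            ≡⟨ F.solve 2 (λ i s → i F.:* s F.:* (i F.:* s) F.:= i F.:* i F.:* (s F.:* s)) refl i s ⟩
    i F.* i F.* (s F.* s)            ≡⟨ cong (i F.* i F.*_) e ⟨
    i F.* i F.* (r F.* r F.* x)      ≡⟨ F.solve 3
        (λ i r x → i F.:* i F.:* (r F.:* r F.:* x) F.:= i F.:* r F.:* (i F.:* r) F.:* x) refl i r x ⟩
    i F.* r F.* (i F.* r) F.* x      ≡⟨ cong (λ z → z F.* z F.* x) (F.inverseˡ r≢0) ⟩
    F.1# F.* F.1# F.* x              ≡⟨ F.solve 1 (λ x → F.:1 F.:* F.:1 F.:* x F.:= x) refl x ⟩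
    x                                ∎))
    where i = r F.⁻¹

  -- Characteristic 0 lets natural numbers be compared inside `K`, which takes the place of a
  -- positivity argument.
  Σ-fromℕ≡0 : ∀ (n : F.Carrier → ℕ) → Σ (λ x → K.fromℕ (n x)) ≡ 0# → ∀ x → n x ≡ 0
  Σ-fromℕ≡0 n e x = go (F.complete x) (sum≡0 (count F.elems) (trans (sym (homo F.elems)) e))
    where
    count : List F.Carrier → ℕ
    count = foldr (λ x m → n x ℕ.+ m) 0
    fromℕ-+ : ∀ m m′ → K.fromℕ (m ℕ.+ m′) ≡ K.fromℕ m + K.fromℕ m′
    fromℕ-+ ℕ.zero  m′ = sym (K.+-identityˡ _)
    fromℕ-+ (suc m) m′ = trans (cong (1# +_) (fromℕ-+ m m′)) (sym (K.+-assoc _ _ _))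
    homo : ∀ xs → foldr (λ x acc → K.fromℕ (n x) + acc) 0# xs ≡ K.fromℕ (count xs)
    homo []       = refl
    homo (x ∷ xs) = trans (cong (K.fromℕ (n x) +_) (homo xs)) (sym (fromℕ-+ (n x) (count xs)))
    sum≡0 : ∀ m → K.fromℕ m ≡ 0# → m ≡ 0
    sum≡0 ℕ.zero  _ = refl
    sum≡0 (suc m) e = ⊥-elim (char0 m e)
    go : ∀ {xs} → x ∈ xs → count xs ≡ 0 → n x ≡ 0
    go {x ∷ xs} (here refl) e = ℕ.m+n≡0⇒m≡0 (n x) e
    go {y ∷ xs} (there p)   e = go p (ℕ.m+n≡0⇒n≡0 (n y) e)

  -- If φ(gh) were 1 for non-squares g, h, the sum of φ(s) + φ(gs) over s, which vanishes,
  -- would have only terms 0 and -2, and the term at h would be 0.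
  φ-nonsquares : ∀ {g h} → φ g ≡ - 1# → (∀ r → ¬ (r F.* r ≡ g)) → φ h ≡ - 1# → φ (g F.* h) ≡ 1#
  φ-nonsquares {g} {h} φg g-non φh = K.mod 1# (trans (cong (_+ φ (g F.* h)) (sym φh)) th≡0)
    (solve 1 (λ z → z := :1 :+ :1 :* (:- :1 :+ z :- :0)) refl (φ (g F.* h)))
    where
    -- The two values of `φ` cancel unless s and g s are both non-squares; that case is the one with
    -- count 1.
    term : ∀ s → ∃ λ n → φ s + φ (g F.* s) ≡ - K.2# * K.fromℕ n
    term s with quadratic s
    ... | zero refl φs = 0 , trans (cong₂ _+_ φs (trans (cong φ (F.zeroʳ g)) φ0)) (solve 0 (:0 :+ :0 := :- :2 :* :0) refl)
    ... | square r r≢0 refl φs = 0 , trans (cong₂ _+_ φs (trans (cong φ (F.*-comm g _)) (trans (φ-scale r≢0 g) φg)))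
      (solve 0 (:1 :+ :- :1 := :- :2 :* :0) refl)
    ... | nonsquare s-non φs with quadratic (g F.* s)
    ...   | zero e _ = ⊥-elim (F.*-≢0 (nonsquare-≢0 g-non) (nonsquare-≢0 s-non) e)
    ...   | square _ _ _ φgs = 0 , trans (cong₂ _+_ φs φgs) (solve 0 (:- :1 :+ :1 := :- :2 :* :0) refl)
    ...   | nonsquare _ φgs = 1 , trans (cong₂ _+_ φs φgs) (solve 0 (:- :1 :+ :- :1 := :- :2 :* (:1 :+ :0)) refl)
    n : F.Carrier → ℕ
    n s = proj₁ (term s)
    total : - K.2# * Σ (λ s → K.fromℕ (n s)) ≡ 0#
    total = begin
      - K.2# * Σ (λ s → K.fromℕ (n s))      ≡⟨ Σ-*ˡ (- K.2#) (λ s → K.fromℕ (n s)) ⟨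
      Σ (λ s → - K.2# * K.fromℕ (n s))      ≡⟨ Σ-cong (λ s → proj₂ (term s)) ⟨
      Σ (λ s → φ s + φ (g F.* s))           ≡⟨ Σ-+ φ (λ s → φ (g F.* s)) ⟩
      Σ φ + Σ (λ s → φ (g F.* s))           ≡⟨ cong₂ _+_ Σφ≡0 (trans (Σ-scale (nonsquare-≢0 g-non) φ) Σφ≡0) ⟩
      0# + 0#                               ≡⟨ K.+-identityˡ 0# ⟩
      0#                                    ∎
    -2≢0 : ¬ (- K.2# ≡ 0#)
    -2≢0 e = char0 1 (K.mod (- 1#) e (solve 0 (:1 :+ (:1 :+ :0) := :0 :+ (:- :1) :* (:- :2 :- :0)) refl))
    th≡0 : φ h + φ (g F.* h) ≡ 0#
    th≡0 = trans (proj₂ (term h)) (trans (cong (λ m → - K.2# * K.fromℕ m)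
      (Σ-fromℕ≡0 n (K.zero-cancelˡ -2≢0 total) h)) (K.zeroʳ _))

  -- Only a product of two non-squares goes beyond `φ-scale`; the counting in `φ-nonsquares` stands
  -- in for the cyclicity of the unit group.
  φ-* : ∀ x y → φ (x F.* y) ≡ φ x * φ y
  φ-* x y with quadratic x | quadratic y
  ... | zero refl φx | _ = trans (cong φ (F.zeroˡ y)) (trans φ0 (sym (trans (cong (_* φ y) φx) (K.zeroˡ _))))
  ... | square r r≢0 refl φx | _ = trans (φ-scale r≢0 y) (sym (trans (cong (_* φ y) φx) (K.*-identityˡ _)))
  ... | _ | zero refl φy = trans (cong φ (F.zeroʳ x)) (trans φ0 (sym (trans (cong (φ x *_) φy) (K.zeroʳ _))))
  ... | _ | square r r≢0 refl φy = trans (cong φ (F.*-comm x _))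
      (trans (φ-scale r≢0 x) (sym (trans (cong (φ x *_) φy) (K.*-identityʳ _))))
  ... | nonsquare x-non φx | nonsquare _ φy = trans (φ-nonsquares φx x-non φy)
    (sym (trans (cong₂ _*_ φx φy) (solve 0 (:- :1 :* :- :1 := :1) refl)))

  Φ : Character
  Φ = record { χ = φ ; χ0 = φ0 ; χ1 = trans (cong φ (sym (F.*-identityˡ F.1#))) (φ-square F.1≢0) ; χmul = φ-* }

  φ⁻¹≡φ : ∀ x → φ x ⁻¹ ≡ φ x
  φ⁻¹≡φ x with quadratic x
  ... | zero refl φx    = trans (cong _⁻¹ φx) (trans K.0⁻¹≡0 (sym φx))
  ... | square _ _ _ φx = trans (cong _⁻¹ φx) (trans K.1⁻¹ (sym φx))
  ... | nonsquare _ φx  = trans (cong _⁻¹ φx) (trans (K.⁻¹-unique (solve 0 (:- :1 :* :- :1 := :1) refl)) (sym φx))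

  χ-/ : ∀ (A : Character) x y → χ A x * χ (A ⁻) y ≡ χ A (x F.* y F.⁻¹)
  χ-/ A x y = trans (cong (χ A x *_) (sym (χ-⁻¹ A y))) (sym (χmul A x (y F.⁻¹)))

  δ-0 : ∀ {x} → x ≡ F.0# → δ x ≡ 1#
  δ-0 {x} = if-yes (x F.≟ F.0#)

  δ-≢0 : ∀ {x} → ¬ (x ≡ F.0#) → δ x ≡ 0#
  δ-≢0 {x} = if-no (x F.≟ F.0#)

  -- Jacobi sums

  J-comm : ∀ (f g : Fn) → J f g ≡ J g f
  J-comm f g = begin
    J f g                                                  ≡⟨ Σ-reflect F.1# (λ t → f t * g (F.1# F.- t)) ⟨
    Σ (λ t → f (F.1# F.- t) * g (F.1# F.- (F.1# F.- t)))
        ≡⟨ Σ-cong (λ t → trans (K.*-comm _ _) (cong (λ z → g z * f (F.1# F.- t))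
        (F.solve 1 (λ t → F.:1 F.:- (F.:1 F.:- t) F.:= t) refl t))) ⟩
    J g f                                                  ∎

  -- For r ≠ 0, scale m by r. At r = 0 scaling is impossible, but the summand collapses to B(-1) (A
  -- B)(m), which is the origin of the δ term.
  Σ-convolution : ∀ (A B : Character) r →
    Σ (λ m → χ A m * χ B (r F.- m)) ≡ χ (A ⊗ B) r * J (χ A) (χ B) + δ r * (χ B (F.- F.1#) * Σ (χ (A ⊗ B)))
  Σ-convolution A B r = by-case r (r F.≟ F.0#)
   where
   by-case : ∀ r → Dec (r ≡ F.0#) →
     Σ (λ m → χ A m * χ B (r F.- m)) ≡ χ (A ⊗ B) r * J (χ A) (χ B) + δ r * (χ B (F.- F.1#) * Σ (χ (A ⊗ B)))
   by-case r (yes refl) = begin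
    Σ (λ m → χ A m * χ B (F.0# F.- m))           ≡⟨ Σ-cong (λ m → trans (cong (λ z → χ A m * χ B z)
        (F.solve 1 (λ m → F.:0 F.:- m F.:= F.:- F.:1 F.:* m) refl m)) (trans (cong (χ A m *_) (χmul B (F.- F.1#) m))
        (solve 3 (λ a b c → a :* (b :* c) := b :* (a :* c)) refl (χ A m) (χ B (F.- F.1#)) (χ B m)))) ⟩
    Σ (λ m → χ B (F.- F.1#) * χ (A ⊗ B) m)       ≡⟨ Σ-*ˡ _ _ ⟩
    S                                            ≡⟨ solve 2 (λ s j → s := :0 :* j :+ :1 :* s) refl S (J (χ A) (χ B)) ⟩
    0# * J (χ A) (χ B) + 1# * S
      ≡⟨ cong₂ (λ y z → y * J (χ A) (χ B) + z * S) (χ0 (A ⊗ B)) (δ-0 refl) ⟨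
    χ (A ⊗ B) F.0# * J (χ A) (χ B) + δ F.0# * S  ∎
    where S = χ B (F.- F.1#) * Σ (χ (A ⊗ B))
   by-case r (no r≢0) = begin
    Σ (λ m → χ A m * χ B (r F.- m))                          ≡⟨ Σ-scale r≢0 _ ⟨
    Σ (λ m → χ A (r F.* m) * χ B (r F.- r F.* m))            ≡⟨ Σ-cong scaled ⟩
    Σ (λ m → χ (A ⊗ B) r * (χ A m * χ B (F.1# F.- m)))       ≡⟨ Σ-*ˡ _ _ ⟩
    χ (A ⊗ B) r * J (χ A) (χ B)                              ≡⟨ solve 2 (λ y s → y := y :+ :0 :* s) refl _ _ ⟩
    χ (A ⊗ B) r * J (χ A) (χ B) + 0# * S                     ≡⟨ cong (λ z → χ (A ⊗ B) r * J (χ A) (χ B) + z * S) (δ-≢0 r≢0) ⟨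
    χ (A ⊗ B) r * J (χ A) (χ B) + δ r * S                    ∎
    where
    S = χ B (F.- F.1#) * Σ (χ (A ⊗ B))
    scaled : ∀ m → χ A (r F.* m) * χ B (r F.- r F.* m) ≡ χ (A ⊗ B) r * (χ A m * χ B (F.1# F.- m))
    scaled m = trans (cong₂ _*_ (χmul A r m)
        (trans (cong (χ B) (F.solve 2 (λ r m → r F.:- r F.:* m F.:= r F.:* (F.:1 F.:- m)) refl r m))
        (χmul B r (F.1# F.- m))))
      (solve 4 (λ a b c d → a :* b :* (c :* d) := a :* c :* (b :* d)) refl (χ A r) (χ A m) (χ B r) (χ B (F.1# F.- m)))

  Σ-convolution₀ : ∀ (A B : Character) → Σ (χ (A ⊗ B)) ≡ 0# → ∀ r →
    Σ (λ m → χ A m * χ B (r F.- m)) ≡ χ (A ⊗ B) r * J (χ A) (χ B)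
  Σ-convolution₀ A B AB≡0 r = trans (Σ-convolution A B r) (trans
    (cong (λ z → χ (A ⊗ B) r * J (χ A) (χ B) + δ r * (χ B (F.- F.1#) * z)) AB≡0)
    (solve 3 (λ y a b → y :+ a :* (b :* :0) := y) refl (χ (A ⊗ B) r * J (χ A) (χ B)) (δ r) (χ B (F.- F.1#))))

  -- The map t to (1 - t u)/(1 - t) is invertible because u ≠ 1. It sends t ≠ 1 onto v ≠ u, the
  -- value u being taken at infinity, so exactly B(u) is missing from the full sum.
  Σ-möbius : ∀ (B : Character) {u} → ¬ (u ≡ F.1#) →
    Σ (λ t → χ B (F.1# F.- t F.* u) * χ (B ⁻) (F.1# F.- t)) ≡ Σ (χ B) - χ B u
  Σ-möbius B {u} u≢1 = trans
    (Σ-reindex (λ t → F.1# F.- t) (λ v → v F.- u) σ τ f0 (λ v e → if-yes (v F.≟ u) (F.x-y≡0⇒x≡y e)) toʳ toˡ)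
    (trans (Σ-change u (λ v → if-no (v F.≟ u)))
      (trans (cong (Σ (χ B) - χ B u +_) (if-yes (u F.≟ u) refl)) (K.+-identityʳ _)))
    where
    σ τ : F.Carrier → F.Carrier
    σ t = (F.1# F.- t F.* u) F.* (F.1# F.- t) F.⁻¹
    τ v = (v F.- F.1#) F.* (v F.- u) F.⁻¹
    f g : Fn
    f t = χ B (F.1# F.- t F.* u) * χ (B ⁻) (F.1# F.- t)
    g v = if does (v F.≟ u) then 0# else χ B v
    f0 : ∀ t → F.1# F.- t ≡ F.0# → f t ≡ 0#
    f0 t e = trans (cong (_ *_) (trans (cong (χ (B ⁻)) e) (χ0 (B ⁻)))) (K.zeroʳ _)
    1-u≢0 : ¬ (F.1# F.- u ≡ F.0#)
    1-u≢0 e = u≢1 (sym (F.x-y≡0⇒x≡y e))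
    toʳ : ∀ t → ¬ (F.1# F.- t ≡ F.0#) → ¬ (σ t F.- u ≡ F.0#) × τ (σ t) ≡ t × f t ≡ g (σ t)
    toʳ t 1-t≢0 = σt-u≢0 , F./-unique σt-u≢0 (F.mod (F.1# F.- t F.* u) (F.inverseʳ _ 1-t≢0)
        (F.solve 3 (λ t u i → (F.:1 F.:- t F.:* u) F.:* i F.:- F.:1 F.:= t F.:* ((F.:1 F.:- t F.:* u) F.:* i F.:- u) F.:+
          (F.:1 F.:- t F.:* u) F.:* ((F.:1 F.:- t) F.:* i F.:- F.:1)) refl t u i))
      , trans (χ-/ B _ _) (sym (if-no (σ t F.≟ u) (λ e → σt-u≢0 (trans (cong (F._- u) e) (F.-‿inverseʳ u)))))
      where
      i = (F.1# F.- t) F.⁻¹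
      σt-u≢0 : ¬ (σ t F.- u ≡ F.0#)
      σt-u≢0 e = F.*-≢0 1-u≢0 (F.⁻¹-≢0 1-t≢0) (trans (sym (F.mod u (F.inverseʳ _ 1-t≢0)
        (F.solve 3 (λ t u i → (F.:1 F.:- t F.:* u) F.:* i F.:- u F.:= (F.:1 F.:- u) F.:* i F.:+
          u F.:* ((F.:1 F.:- t) F.:* i F.:- F.:1)) refl t u i))) e)
    toˡ : ∀ v → ¬ (v F.- u ≡ F.0#) → ¬ (F.1# F.- τ v ≡ F.0#) × σ (τ v) ≡ v
    toˡ v v-u≢0 = 1-τv≢0 , F./-unique 1-τv≢0 (F.mod (v F.- F.1#) (F.inverseʳ _ v-u≢0)
        (F.solve 3 (λ v u j → F.:1 F.:- (v F.:- F.:1) F.:* j F.:* u F.:= v F.:* (F.:1 F.:- (v F.:- F.:1) F.:* j) F.:+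
          (v F.:- F.:1) F.:* ((v F.:- u) F.:* j F.:- F.:1)) refl v u j))
      where
      j = (v F.- u) F.⁻¹
      1-τv≢0 : ¬ (F.1# F.- τ v ≡ F.0#)
      1-τv≢0 e = F.*-≢0 1-u≢0 (F.⁻¹-≢0 v-u≢0) (trans (sym (F.mod (F.- F.1#) (F.inverseʳ _ v-u≢0)
        (F.solve 3 (λ v u j → F.:1 F.:- (v F.:- F.:1) F.:* j F.:= (F.:1 F.:- u) F.:* j F.:+
          (F.:- F.:1) F.:* ((v F.:- u) F.:* j F.:- F.:1)) refl v u j))) e)

  -- Scaling the summation variable of the first factor by that of the second, t, cancels A(t)
  -- against Ā(t); what remains to be summed over t is the sum in `Σ-möbius`. Keeping the three
  -- character sums makes the formula valid for trivial characters as well.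
  J*J⁻ : ∀ (A B : Character) → J (χ A) (χ B) * J (χ (A ⁻)) (χ (B ⁻)) ≡
    q + Σ (χ A) * Σ (χ B) - Σ (χ A) - Σ (χ B) - Σ (χ (A ⊗ B))
  J*J⁻ A B = begin
    j * J (χ (A ⁻)) (χ (B ⁻))      ≡⟨ Σ-*ˡ j _ ⟨
    Σ f                            ≡⟨ Σ-change F.0# f≡h ⟩
    Σ h - h F.0# + f F.0#          ≡⟨ cong₂ (λ y z → y - h F.0# + z) Σh f0≡0 ⟩
    Σ (λ u → χ A u * M u) - h F.0# + 0#
      ≡⟨ cong₂ (λ y z → y - z + 0#) ΣAM h0≡ ⟩
    SA * SB - SAB - (1# * (SB - 1#)) + 1# * (q - 1#) - SA + 0#
      ≡⟨ solve 4 (λ q a b c → a :* b :- c :- (:1 :* (b :- :1)) :+ :1 :* (q :- :1) :- a :+ :0 := q :+ a :* b :- a :- b :- c) refl q SA SB SAB ⟩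
    q + SA * SB - SA - SB - SAB    ∎
    where
    j = J (χ A) (χ B)
    SA = Σ (χ A)
    SB = Σ (χ B)
    SAB = Σ (χ (A ⊗ B))
    f h M : Fn
    f t = j * (χ (A ⁻) t * χ (B ⁻) (F.1# F.- t))
    h t = Σ (λ u → χ A u * (χ B (F.1# F.- t F.* u) * χ (B ⁻) (F.1# F.- t)))
    M u = Σ (λ t → χ B (F.1# F.- t F.* u) * χ (B ⁻) (F.1# F.- t))
    f0≡0 : f F.0# ≡ 0#
    f0≡0 = trans (cong (λ z → j * (z * χ (B ⁻) (F.1# F.- F.0#))) (χ0 (A ⁻)))
        (solve 2 (λ j z → j :* (:0 :* z) := :0) refl j _)
    h0≡ : h F.0# ≡ SA
    h0≡ = Σ-cong (λ u → trans (cong₂ (λ y z → χ A u * (y * z))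
        (trans (cong (χ B) (F.solve 1 (λ u → F.:1 F.:- F.:0 F.:* u F.:= F.:1) refl u)) (χ1 B))
        (trans (cong (χ (B ⁻)) (F.solve 0 (F.:1 F.:- F.:0 F.:= F.:1) refl)) (χ1 (B ⁻))))
      (solve 1 (λ a → a :* (:1 :* :1) := a) refl (χ A u)))
    f≡h : ∀ t → ¬ (t ≡ F.0#) → f t ≡ h t
    f≡h t t≢0 = begin
      j * (χ (A ⁻) t * χ (B ⁻) (F.1# F.- t))       ≡⟨ cong (_* (χ (A ⁻) t * χ (B ⁻) (F.1# F.- t))) (Σ-scale t≢0 _) ⟨
      Σ (λ u → χ A (t F.* u) * χ B (F.1# F.- t F.* u)) * (χ (A ⁻) t * χ (B ⁻) (F.1# F.- t))
                                                   ≡⟨ Σ-*ʳ _ _ ⟨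
      Σ (λ u → χ A (t F.* u) * χ B (F.1# F.- t F.* u) * (χ (A ⁻) t * χ (B ⁻) (F.1# F.- t)))
        ≡⟨ Σ-cong (λ u → trans (cong (λ z → z * _ * (_ * _)) (χmul A t u))
          (K.mod (χ A u * χ B (F.1# F.- t F.* u) * χ (B ⁻) (F.1# F.- t)) (χ-⁻ʳ A t≢0)
            (solve 5 (λ a a⁻ x y z → a :* x :* y :* (a⁻ :* z) := x :* (y :* z) :+ x :* y :* z :* (a :* a⁻ :- :1)) refl
              (χ A t) (χ (A ⁻) t) (χ A u) (χ B (F.1# F.- t F.* u)) (χ (B ⁻) (F.1# F.- t))))) ⟩
      h t                                          ∎
    Σh : Σ h ≡ Σ (λ u → χ A u * M u)
    Σh = trans (Σ-swap _) (Σ-cong (λ u → Σ-*ˡ (χ A u) _))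
    -- The point u = 1 is excluded from `Σ-möbius`; there the summand is the trivial character at 1
    -- - t.
    M1 : M F.1# ≡ q - 1#
    M1 = trans (Σ-cong (λ t → cong (λ z → χ B (F.1# F.- z) * χ (B ⁻) (F.1# F.- t)) (F.*-identityʳ t)))
      (trans (Σ-reflect F.1# (χ (B ⊗ B ⁻))) (Σ-χχ⁻ B))
    ΣAM : Σ (λ u → χ A u * M u) ≡ SA * SB - SAB - (1# * (SB - 1#)) + 1# * (q - 1#)
    ΣAM = begin
      Σ (λ u → χ A u * M u)
        ≡⟨ Σ-change F.1# (λ u u≢1 → cong (χ A u *_) (Σ-möbius B u≢1)) ⟩
      Σ (λ u → χ A u * (SB - χ B u)) - χ A F.1# * (SB - χ B F.1#) + χ A F.1# * M F.1#
        ≡⟨ cong₂ (λ y z → Σ (λ u → χ A u * (SB - χ B u)) - y * (SB - z) + y * M F.1#) (χ1 A) (χ1 B) ⟩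
      Σ (λ u → χ A u * (SB - χ B u)) - 1# * (SB - 1#) + 1# * M F.1#
        ≡⟨ cong₂ (λ y z → y - 1# * (SB - 1#) + 1# * z) split M1 ⟩
      SA * SB - SAB - 1# * (SB - 1#) + 1# * (q - 1#)   ∎
      where
      split : Σ (λ u → χ A u * (SB - χ B u)) ≡ SA * SB - SAB
      split = begin
        Σ (λ u → χ A u * (SB - χ B u))
            ≡⟨ Σ-cong (λ u → solve 3 (λ a s b → a :* (s :- b) := a :* s :+ :- :1 :* (a :* b)) refl (χ A u) SB (χ B u)) ⟩
        Σ (λ u → χ A u * SB + - 1# * χ (A ⊗ B) u) ≡⟨ Σ-+ _ _ ⟩
        Σ (λ u → χ A u * SB) + Σ (λ u → - 1# * χ (A ⊗ B) u)   ≡⟨ cong₂ _+_ (Σ-*ʳ SB (χ A)) (Σ-*ˡ (- 1#) (χ (A ⊗ B))) ⟩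
        SA * SB + - 1# * SAB                      ≡⟨ solve 2 (λ x y → x :+ :- :1 :* y := x :- y) refl (SA * SB) SAB ⟩
        SA * SB - SAB                             ∎

  -- When the goal is `⊥`, the case distinction on triviality becomes legitimate.
  Σχ-cases : ∀ (A : Character) → (Σ (χ A) ≡ 0# → ⊥) → (Σ (χ A) ≡ q - 1# → ⊥) → ⊥
  Σχ-cases A S≢0 S≢q-1 = S≢q-1 (Σχ≢0⇒≡q-1 A S≢0)

  -- By `J*J⁻` the norm is q if A, B and A B are all nontrivial, 1 if exactly one of them is
  -- trivial, and (q - 2)² if all are.
  J≢0 : ∀ (A B : Character) → ¬ (J (χ A) (χ B) ≡ 0#)
  J≢0 A B j≡0 = Σχ-cases A
    (λ a → Σχ-cases B
      (λ b → Σχ-cases (A ⊗ B)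
        (λ c → q≢0 (trans (solve 1 (λ q → q := q :+ :0 :* :0 :- :0 :- :0 :- :0) refl q) (norm≡0 a b c)))
        (λ c → K.1≢0 (trans (solve 1 (λ q → :1 := q :+ :0 :* :0 :- :0 :- :0 :- (q :- :1)) refl q) (norm≡0 a b c))))
      (λ b → K.1≢0 (trans (solve 1 (λ q → :1 := q :+ :0 :* (q :- :1) :- :0 :- (q :- :1) :- :0) refl q)
        (norm≡0 a b (absorbed b (trans BA (cong (Σ (χ B) *_) a)))))))
    (λ a → Σχ-cases B
      (λ b → K.1≢0 (trans (solve 1 (λ q → :1 := q :+ (q :- :1) :* :0 :- (q :- :1) :- :0 :- :0) refl q)
        (norm≡0 a b (absorbed a (trans (Σχ*Σχ A B) (cong (Σ (χ A) *_) b))))))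
      (λ b → K.*-≢0 q-2≢0 q-2≢0
        (trans (solve 1 (λ q → (q :- :2) :* (q :- :2) := q :+ (q :- :1) :* (q :- :1) :- (q :- :1) :- (q :- :1) :- (q :- :1)) refl q)
        (norm≡0 a b (absorbed a (trans (Σχ*Σχ A B) (cong (Σ (χ A) *_) b)))))))
    where
    BA : Σ (χ B) * Σ (χ (A ⊗ B)) ≡ Σ (χ B) * Σ (χ A)
    BA = trans (cong (Σ (χ B) *_) (Σ-cong (λ x → K.*-comm (χ A x) (χ B x)))) (Σχ*Σχ B A)
    absorbed : ∀ {s t} → s ≡ q - 1# → s * Σ (χ (A ⊗ B)) ≡ s * t → Σ (χ (A ⊗ B)) ≡ t
    absorbed refl = K.*-cancelˡ q-1≢0
    norm≡0 : ∀ {a b c} → Σ (χ A) ≡ a → Σ (χ B) ≡ b → Σ (χ (A ⊗ B)) ≡ c → q + a * b - a - b - c ≡ 0#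
    norm≡0 refl refl refl = trans (sym (J*J⁻ A B)) (trans (cong (_* J (χ (A ⁻)) (χ (B ⁻))) j≡0) (K.zeroˡ _))

  χ⁻-⁻¹ : ∀ (A : Character) x → χ (A ⁻) (x F.⁻¹) ≡ χ A x
  χ⁻-⁻¹ A x = trans (sym (χ-⁻¹ A (x F.⁻¹))) (cong (χ A) (⁻¹-involutive (x F.≟ F.0#)))
    where
    ⁻¹-involutive : Dec (x ≡ F.0#) → x F.⁻¹ F.⁻¹ ≡ x
    ⁻¹-involutive (yes refl) = trans (cong F._⁻¹ F.0⁻¹≡0) F.0⁻¹≡0
    ⁻¹-involutive (no x≢0)   = F.⁻¹-unique (F.inverseˡ x≢0)

  δ-* : ∀ x {t} → ¬ (t ≡ F.0#) → δ (x F.* t) ≡ δ x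
  δ-* x {t} t≢0 = by-case (x F.≟ F.0#)
    where
    by-case : Dec (x ≡ F.0#) → δ (x F.* t) ≡ δ x
    by-case (yes x≡0) = trans (δ-0 (trans (cong (F._* t) x≡0) (F.zeroˡ t))) (sym (δ-0 x≡0))
    by-case (no x≢0)  = trans (δ-≢0 (F.*-≢0 x≢0 t≢0)) (sym (δ-≢0 x≢0))

  -- The quadratic transformation

  -- The involution y to (1 - y)/(1 - l y) turns each of y, 1 - y and 1 - l y into a product of
  -- powers of these same factors and of 1 - l. For l = 1 it would be constant.
  Σ-euler : ∀ (A D E : Character) {l} → ¬ (F.1# F.- l ≡ F.0#) →
    Σ (λ y → χ D y * χ A (F.1# F.- y) * χ E (F.1# F.- l F.* y)) ≡
    Σ (λ z → χ (A ⊗ E) (F.1# F.- l) * (χ A z * χ D (F.1# F.- z) * χ ((D ⊗ A ⊗ E) ⁻) (F.1# F.- l F.* z)))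
  Σ-euler A D E {l} 1-l≢0 = Σ-reindex u u σ σ f0 g0
    (λ y uy≢0 → uσ≢0 uy≢0 , σσ uy≢0 , term uy≢0) (λ y uy≢0 → uσ≢0 uy≢0 , σσ uy≢0)
    where
    T = D ⊗ A ⊗ E
    u σ : F.Carrier → F.Carrier
    u y = F.1# F.- l F.* y
    σ y = (F.1# F.- y) F.* u y F.⁻¹
    f g : Fn
    f y = χ D y * χ A (F.1# F.- y) * χ E (u y)
    g z = χ (A ⊗ E) (F.1# F.- l) * (χ A z * χ D (F.1# F.- z) * χ (T ⁻) (u z))
    f0 : ∀ y → u y ≡ F.0# → f y ≡ 0#
    f0 y e = trans (cong (_ *_) (trans (cong (χ E) e) (χ0 E))) (K.zeroʳ _)
    g0 : ∀ y → u y ≡ F.0# → g y ≡ 0#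
    g0 y e = trans (cong (λ z → χ (A ⊗ E) (F.1# F.- l) * (χ A y * χ D (F.1# F.- y) * z))
        (trans (cong (χ (T ⁻)) e) (χ0 (T ⁻))))
      (solve 2 (λ c d → c :* (d :* :0) := :0) refl _ _)
    uσ : ∀ {y} → ¬ (u y ≡ F.0#) → u (σ y) ≡ (F.1# F.- l) F.* u y F.⁻¹
    uσ {y} uy≢0 = F.mod (F.- F.1#) (F.inverseʳ _ uy≢0) (F.solve 3 (λ l y i →
      F.:1 F.:- l F.:* ((F.:1 F.:- y) F.:* i) F.:= (F.:1 F.:- l) F.:* i F.:+ (F.:- F.:1) F.:* ((F.:1 F.:- l F.:* y) F.:* i F.:- F.:1))
      refl l y (u y F.⁻¹))
    uσ≢0 : ∀ {y} → ¬ (u y ≡ F.0#) → ¬ (u (σ y) ≡ F.0#)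
    uσ≢0 uy≢0 e = F.*-≢0 1-l≢0 (F.⁻¹-≢0 uy≢0) (trans (sym (uσ uy≢0)) e)
    1-σ : ∀ {y} → ¬ (u y ≡ F.0#) → F.1# F.- σ y ≡ y F.* (F.1# F.- l) F.* u y F.⁻¹
    1-σ {y} uy≢0 = F.mod (F.- F.1#) (F.inverseʳ _ uy≢0) (F.solve 3 (λ l y i →
      F.:1 F.:- (F.:1 F.:- y) F.:* i F.:= y F.:* (F.:1 F.:- l) F.:* i F.:+ (F.:- F.:1) F.:* ((F.:1 F.:- l F.:* y) F.:* i F.:- F.:1))
      refl l y (u y F.⁻¹))
    σσ : ∀ {y} → ¬ (u y ≡ F.0#) → σ (σ y) ≡ y
    σσ {y} uy≢0 = F./-unique (uσ≢0 uy≢0) (trans (1-σ uy≢0) (trans (F.*-assoc _ _ _) (cong (y F.*_) (sym (uσ uy≢0)))))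
    term : ∀ {y} → ¬ (u y ≡ F.0#) → f y ≡ g (σ y)
    term {y} uy≢0 = sym (begin
      χ (A ⊗ E) k * (χ A (σ y) * χ D (F.1# F.- σ y) * χ (T ⁻) (u (σ y)))
        ≡⟨ cong₂ (λ r s → χ (A ⊗ E) k * (χ A (σ y) * χ D r * χ (T ⁻) s)) (1-σ uy≢0) (uσ uy≢0) ⟩
      χ (A ⊗ E) k * (χ A (σ y) * χ D (y F.* k F.* i) * T⁻)
        ≡⟨ cong₂ (λ r s → χ (A ⊗ E) k * (r * s * T⁻)) (χmul A _ i) (trans (χmul D _ i) (cong (_* χ D i) (χmul D y k))) ⟩
      χ A k * χ E k * (χ A (F.1# F.- y) * χ A i * (χ D y * χ D k * χ D i) * T⁻)
        ≡⟨ K.mod (- (χ A k * χ E k * (χ A (F.1# F.- y) * χ A i * (χ D y * χ D k * χ D i) * T⁻))) E-inv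
          (solve 10 (λ ak ek ay ai dy dk di t ew ei →
            ak :* ek :* (ay :* ai :* (dy :* dk :* di) :* t) :=
            dy :* ay :* ew :* (dk :* di :* (ak :* ai) :* (ek :* ei) :* t) :+
            (:- (ak :* ek :* (ay :* ai :* (dy :* dk :* di) :* t))) :* (ew :* ei :- :1)) refl
            (χ A k) (χ E k) (χ A (F.1# F.- y)) (χ A i) (χ D y) (χ D k) (χ D i) T⁻ (χ E (u y)) (χ E i)) ⟩
      χ D y * χ A (F.1# F.- y) * χ E (u y) * (χ D k * χ D i * (χ A k * χ A i) * (χ E k * χ E i) * T⁻)
        ≡⟨ cong (λ z → f y * (z * T⁻)) (cong₂ _*_ (cong₂ _*_ (χmul D k i) (χmul A k i)) (χmul E k i)) ⟨
      f y * (χ T (k F.* i) * T⁻)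
        ≡⟨ cong (f y *_) (χ-⁻ʳ T (F.*-≢0 1-l≢0 (F.⁻¹-≢0 uy≢0))) ⟩
      f y * 1#   ≡⟨ K.*-identityʳ _ ⟩
      f y        ∎)
      where
      k = F.1# F.- l
      i = u y F.⁻¹
      T⁻ = χ (T ⁻) (k F.* i)
      E-inv : χ E (u y) * χ E i ≡ 1#
      E-inv = χ-inverseʳ E uy≢0

  J-cong : ∀ {f f′ g g′ : Fn} → (∀ t → f t ≡ f′ t) → (∀ t → g t ≡ g′ t) → J f g ≡ J f′ g′
  J-cong f≡ g≡ = Σ-cong (λ t → cong₂ _*_ (f≡ t) (g≡ (F.1# F.- t)))

  φ*φ≡1 : ∀ {x} → ¬ (x ≡ F.0#) → φ x * φ x ≡ 1#
  φ*φ≡1 {x} x≢0 = trans (cong (φ x *_) (sym (φ⁻¹≡φ x))) (χ-⁻ʳ Φ x≢0)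

  -- From the left numerator to the right one, for x ≠ -1

  module Nondegenerate (B D : Character) (ΣDB⁻≡0 : Σ (χ (D ⊗ B ⁻)) ≡ 0#)
           (ΣΦD≡0 : Σ (χ (Φ ⊗ D)) ≡ 0#) (ΣΦD⁻≡0 : Σ (χ (Φ ⊗ D ⁻)) ≡ 0#) where

    A : Character
    A = D ⊗ B ⁻

    AD⁻≡B⁻ : ∀ x → χ (A ⊗ D ⁻) x ≡ χ (B ⁻) x
    AD⁻≡B⁻ = χ-ext (A ⊗ D ⁻) (B ⁻) (λ x x≢0 → K.mod (χ (B ⁻) x) (χ-⁻ʳ D x≢0)
      (solve 3 (λ d b d⁻ → d :* b :* d⁻ := b :+ b :* (d :* d⁻ :- :1)) refl (χ D x) (χ (B ⁻) x) (χ (D ⁻) x)))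

    -- `ω` absorbs the factor 4 produced by u = 1 - x + 2 z; `κ` comes from the convolution of φ and
    -- D̄.
    ω κ : K.Carrier
    ω = χ (D ⁻) F.4#
    κ = χ (D ⁻) (F.- F.1#) * J φ (χ (D ⁻))

    -- The δ term of the convolution at r = 0 carries the sum of φD̄, which vanishes, so one formula
    -- serves for all `r`.
    Σ-D⁻[u²-r] : ∀ r → Σ (λ u → χ (D ⁻) (u F.* u F.- r)) ≡ Σ (χ (D ⁻)) + κ * χ (Φ ⊗ D ⁻) r
    Σ-D⁻[u²-r] r = begin
      Σ (λ u → χ (D ⁻) (u F.* u F.- r))                    ≡⟨ Σ-square (λ s → χ (D ⁻) (s F.- r)) ⟩
      Σ (λ s → χ (D ⁻) (s F.- r)) + Σ (λ s → φ s * χ (D ⁻) (s F.- r))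
        ≡⟨ cong₂ _+_ (Σ-translate (F.- r) (χ (D ⁻))) (Σ-cong (λ s → trans
          (cong (φ s *_) (trans (cong (χ (D ⁻)) (F.solve 2 (λ s r → s F.:- r F.:= (F.:- F.:1) F.:* (r F.:- s))
              refl s r)) (χmul (D ⁻) _ _)))
          (solve 3 (λ a b c → a :* (b :* c) := b :* (a :* c)) refl (φ s) (χ (D ⁻) (F.- F.1#)) (χ (D ⁻) (r F.- s))))) ⟩
      Σ (χ (D ⁻)) + Σ (λ s → χ (D ⁻) (F.- F.1#) * (φ s * χ (D ⁻) (r F.- s)))
        ≡⟨ cong (Σ (χ (D ⁻)) +_) (trans (Σ-*ˡ _ _) (cong (χ (D ⁻) (F.- F.1#) *_) (Σ-convolution₀ Φ (D ⁻) ΣΦD⁻≡0 r))) ⟩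
      Σ (χ (D ⁻)) + χ (D ⁻) (F.- F.1#) * (χ (Φ ⊗ D ⁻) r * J φ (χ (D ⁻)))
        ≡⟨ solve 4 (λ s a b c → s :+ a :* (b :* c) := s :+ a :* c :* b) refl (Σ (χ (D ⁻))) (χ (D ⁻) (F.- F.1#))
            (χ (Φ ⊗ D ⁻) r) (J φ (χ (D ⁻))) ⟩
      Σ (χ (D ⁻)) + κ * χ (Φ ⊗ D ⁻) r                      ∎

    -- The factor D D̄ only removes y = 1 from the vanishing sum of A.
    Σ-A-off-1 : Σ (λ y → χ A y * χ (D ⊗ D ⁻) (F.1# F.- y)) ≡ - 1#
    Σ-A-off-1 = begin
      Σ f                        ≡⟨ Σ-change F.1# (λ y y≢1 → trans
        (cong (χ A y *_) (χ-⁻ʳ D (λ e → y≢1 (sym (F.x-y≡0⇒x≡y e))))) (K.*-identityʳ _)) ⟩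
      Σ (χ A) - χ A F.1# + f F.1#  ≡⟨ cong₂ _+_ (cong₂ _-_ ΣDB⁻≡0 (χ1 A)) f1 ⟩
      0# - 1# + 0#               ≡⟨ solve 0 (:0 :- :1 :+ :0 := :- :1) refl ⟩
      - 1#                       ∎
      where
      f : Fn
      f y = χ A y * χ (D ⊗ D ⁻) (F.1# F.- y)
      f1 : f F.1# ≡ 0#
      f1 = trans (cong (χ A F.1# *_) (trans (cong (χ (D ⊗ D ⁻)) (F.-‿inverseʳ F.1#)) (χ0 (D ⊗ D ⁻)))) (K.zeroʳ _)

    -- Either the sum of D̄ vanishes, or D is trivial and J(A,D) = -1; the factor in front merges
    -- the two cases.
    ΣD⁻*J : Σ (χ (D ⁻)) * J (χ A) (χ D) ≡ - Σ (χ (D ⁻))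
    ΣD⁻*J = begin
      Σ (χ (D ⁻)) * J (χ A) (χ D)
        ≡⟨ absorb-Σ (D ⁻) (λ y → F.1# F.- y) (λ y e → trans (cong (χ A y *_) (trans (cong (χ D) e) (χ0 D))) (K.zeroʳ _)) ⟨
      Σ (χ (D ⁻)) * Σ (λ y → χ (D ⁻) (F.1# F.- y) * (χ A y * χ D (F.1# F.- y)))
        ≡⟨ cong (Σ (χ (D ⁻)) *_) (trans (Σ-cong (λ y → solve 3 (λ a b c → a :* (b :* c) := b :* (c :* a)) refl
            (χ (D ⁻) (F.1# F.- y)) (χ A y) (χ D (F.1# F.- y)))) Σ-A-off-1) ⟩
      Σ (χ (D ⁻)) * - 1#     ≡⟨ solve 1 (λ s → s :* (:- :1) := :- s) refl _ ⟩
      - Σ (χ (D ⁻))          ∎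

    module _ (x : F.Carrier) where
      Δ : F.Carrier → F.Carrier
      Δ y = (F.1# F.- x) F.* (F.1# F.- x) F.+ F.4# F.* x F.* y

      M : F.Carrier → F.Carrier → F.Carrier
      M z y = z F.* (z F.+ F.1# F.- x) F.- x F.* y

      -- What `M z y` becomes after division by 1 - y, in terms of p = (z + y)/(1 - y). Unlike `M`,
      -- it has degree one in z, so that summing over z gives a convolution.
      L : F.Carrier → F.Carrier → F.Carrier
      L z p = z F.* (p F.+ F.1#) F.- x F.* p

      I I′ : F.Carrier → Fn
      I  z y = χ A y * χ D (F.1# F.- y) * χ (D ⁻) (M z y)
      I′ z p = χ A (p F.- z) * χ (A ⁻) (p F.+ F.1#) * χ (D ⁻) (L z p)

      -- The Möbius map y to (z + y)/(1 - y) has determinant z + 1, so z = -1 is the only value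
      -- where it fails to be invertible; both sums are evaluated separately there.
      ΣI≡ΣI′ : ∀ z → ¬ (z ≡ F.- F.1#) → Σ (I z) ≡ Σ (I′ z)
      ΣI≡ΣI′ z z≢-1 = Σ-reindex (λ y → F.1# F.- y) (λ p → p F.+ F.1#) σ τ
        (λ y e → trans (cong (λ w → χ A y * w * χ (D ⁻) (M z y)) (trans (cong (χ D) e) (χ0 D)))
            (solve 2 (λ a b → a :* :0 :* b := :0) refl _ _))
        (λ p e → trans (cong (λ w → χ A (p F.- z) * w * χ (D ⁻) (L z p)) (trans (cong (χ (A ⁻)) e) (χ0 (A ⁻))))
            (solve 2 (λ a b → a :* :0 :* b := :0) refl _ _))
        toʳ toˡ
        where
        σ τ : F.Carrier → F.Carrier
        σ y = (z F.+ y) F.* (F.1# F.- y) F.⁻¹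
        τ p = (p F.- z) F.* (p F.+ F.1#) F.⁻¹
        z+1≢0 : ¬ (z F.+ F.1# ≡ F.0#)
        z+1≢0 e = z≢-1 (F.mod F.1# e (F.solve 1 (λ z → z F.:= F.:- F.:1 F.:+ F.:1 F.:* (z F.:+ F.:1 F.:- F.:0)) refl z))
        toʳ : ∀ y → ¬ (F.1# F.- y ≡ F.0#) → ¬ (σ y F.+ F.1# ≡ F.0#) × τ (σ y) ≡ y × I z y ≡ I′ z (σ y)
        toʳ y 1-y≢0 = σ+1≢0 , F./-unique σ+1≢0 (trans σ-z (trans (F.*-assoc _ _ _) (cong (y F.*_) (sym σ+1)))) , sym (begin
          χ A (σ y F.- z) * χ (A ⁻) (σ y F.+ F.1#) * χ (D ⁻) (L z (σ y))
            ≡⟨ cong₂ _*_ (cong₂ (λ r s → χ A r * χ (A ⁻) s) σ-z σ+1) (cong (χ (D ⁻)) Lσ) ⟩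
          χ A (y F.* (z F.+ F.1#) F.* i) * χ (A ⁻) ((z F.+ F.1#) F.* i) * χ (D ⁻) (M z y F.* i)
            ≡⟨ cong₂ _*_ (cong (λ r → r * χ (A ⁻) ((z F.+ F.1#) F.* i)) (trans (cong (χ A) (F.*-assoc _ _ _)) (χmul A y _)))
                 (trans (χmul (D ⁻) _ i) (cong (χ (D ⁻) (M z y) *_) (χ⁻-⁻¹ D (F.1# F.- y)))) ⟩
          χ A y * χ A ((z F.+ F.1#) F.* i) * χ (A ⁻) ((z F.+ F.1#) F.* i) * (χ (D ⁻) (M z y) * χ D (F.1# F.- y))
            ≡⟨ K.mod (I z y) (χ-⁻ʳ A (F.*-≢0 z+1≢0 (F.⁻¹-≢0 1-y≢0)))
               (solve 5 (λ a b c m d → a :* b :* c :* (m :* d) := a :* d :* m :+ a :* d :* m :* (b :* c :- :1)) refl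
                 (χ A y) (χ A ((z F.+ F.1#) F.* i)) (χ (A ⁻) ((z F.+ F.1#) F.* i)) (χ (D ⁻) (M z y)) (χ D (F.1# F.- y))) ⟩
          I z y     ∎)
          where
          i = (F.1# F.- y) F.⁻¹
          ii = F.inverseʳ _ 1-y≢0
          σ+1 : σ y F.+ F.1# ≡ (z F.+ F.1#) F.* i
          σ+1 = F.mod (F.- F.1#) ii (F.solve 3 (λ z y i → (z F.:+ y) F.:* i F.:+ F.:1 F.:=
            (z F.:+ F.:1) F.:* i F.:+ (F.:- F.:1) F.:* ((F.:1 F.:- y) F.:* i F.:- F.:1)) refl z y i)
          σ-z : σ y F.- z ≡ y F.* (z F.+ F.1#) F.* i
          σ-z = F.mod z ii (F.solve 3 (λ z y i → (z F.:+ y) F.:* i F.:- z F.:=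
            y F.:* (z F.:+ F.:1) F.:* i F.:+ z F.:* ((F.:1 F.:- y) F.:* i F.:- F.:1)) refl z y i)
          Lσ : L z (σ y) ≡ M z y F.* i
          Lσ = F.mod (F.- z) ii (F.solve 4 (λ x z y i → z F.:* ((z F.:+ y) F.:* i F.:+ F.:1) F.:- x F.:* ((z F.:+ y) F.:* i) F.:=
            (z F.:* (z F.:+ F.:1 F.:- x) F.:- x F.:* y) F.:* i F.:+ (F.:- z) F.:* ((F.:1 F.:- y) F.:* i F.:- F.:1))
                refl x z y i)
          σ+1≢0 : ¬ (σ y F.+ F.1# ≡ F.0#)
          σ+1≢0 e = F.*-≢0 z+1≢0 (F.⁻¹-≢0 1-y≢0) (trans (sym σ+1) e)
        toˡ : ∀ p → ¬ (p F.+ F.1# ≡ F.0#) → ¬ (F.1# F.- τ p ≡ F.0#) × σ (τ p) ≡ p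
        toˡ p p+1≢0 = 1-τ≢0 , F./-unique 1-τ≢0 (F.mod (p F.- z) ii
          (F.solve 3 (λ z p i → z F.:+ (p F.:- z) F.:* i F.:= p F.:* (F.:1 F.:- (p F.:- z) F.:* i) F.:+
            (p F.:- z) F.:* ((p F.:+ F.:1) F.:* i F.:- F.:1)) refl z p i))
          where
          i = (p F.+ F.1#) F.⁻¹
          ii = F.inverseʳ _ p+1≢0
          1-τ≢0 : ¬ (F.1# F.- τ p ≡ F.0#)
          1-τ≢0 e = F.*-≢0 z+1≢0 (F.⁻¹-≢0 p+1≢0) (trans (sym (F.mod (F.- F.1#) ii
            (F.solve 3 (λ z p i → F.:1 F.:- (p F.:- z) F.:* i F.:= (z F.:+ F.:1) F.:* i F.:+
              (F.:- F.:1) F.:* ((p F.:+ F.:1) F.:* i F.:- F.:1)) refl z p i))) e)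

      -- At z = -1, `M` factors as x (1 - y), and D cancels D̄ off y = 1.
      ΣI-1 : Σ (I (F.- F.1#)) ≡ - χ (D ⁻) x
      ΣI-1 = begin
        Σ (I (F.- F.1#))    ≡⟨ Σ-cong (λ y → trans (cong (χ A y * χ D (F.1# F.- y) *_)
            (trans (cong (χ (D ⁻)) (F.solve 2 (λ x y → (F.:- F.:1) F.:* ((F.:- F.:1) F.:+ F.:1 F.:- x) F.:- x F.:* y F.:= x F.:* (F.:1 F.:- y)) refl x y))
              (χmul (D ⁻) x _)))
            (solve 4 (λ a b c d → a :* b :* (c :* d) := c :* (a :* (b :* d))) refl (χ A y) (χ D (F.1# F.- y))
                (χ (D ⁻) x) (χ (D ⁻) (F.1# F.- y)))) ⟩
        Σ (λ y → χ (D ⁻) x * (χ A y * χ (D ⊗ D ⁻) (F.1# F.- y)))   ≡⟨ Σ-*ˡ _ _ ⟩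
        χ (D ⁻) x * Σ (λ y → χ A y * χ (D ⊗ D ⁻) (F.1# F.- y))     ≡⟨ cong (χ (D ⁻) x *_) Σ-A-off-1 ⟩
        χ (D ⁻) x * - 1#    ≡⟨ solve 1 (λ s → s :* (:- :1) := :- s) refl _ ⟩
        - χ (D ⁻) x         ∎

      -- At z = -1, `L` is affine in p with slope -(1 + x), hence a bijection; A and Ā cancel and
      -- only remove p = -1, where `L` equals x.
      ΣI′-1 : ¬ (F.1# F.+ x ≡ F.0#) → Σ (I′ (F.- F.1#)) ≡ Σ (χ (D ⁻)) - χ (D ⁻) x
      ΣI′-1 1+x≢0 = begin
        Σ f                  ≡⟨ Σ-change (F.- F.1#) off ⟩
        Σ g - g (F.- F.1#) + f (F.- F.1#)     ≡⟨ trans (cong₂ _+_ (cong₂ _-_ Σg g-1) f-1) (K.+-identityʳ _) ⟩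
        Σ (χ (D ⁻)) - χ (D ⁻) x               ∎
        where
        f g : Fn
        f = I′ (F.- F.1#)
        g p = χ (D ⁻) (L (F.- F.1#) p)
        Σg : Σ g ≡ Σ (χ (D ⁻))
        Σg = trans (Σ-cong (λ p → cong (χ (D ⁻)) (F.solve 2 (λ x p →
            (F.:- F.:1) F.:* (p F.:+ F.:1) F.:- x F.:* p F.:= (F.:- F.:1 F.:* (F.:1 F.:+ x)) F.:* p F.:+ F.:- F.:1)
                refl x p)))
          (trans (Σ-scale (F.*-≢0 F.-1≢0 1+x≢0) (λ w → χ (D ⁻) (w F.+ F.- F.1#))) (Σ-translate (F.- F.1#) (χ (D ⁻))))
        f-1 : f (F.- F.1#) ≡ 0#
        f-1 = trans (cong (λ w → χ A (F.- F.1# F.- F.- F.1#) * w * χ (D ⁻) (L (F.- F.1#) (F.- F.1#)))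
          (trans (cong (χ (A ⁻)) (F.-‿inverseˡ F.1#)) (χ0 (A ⁻)))) (solve 2 (λ a b → a :* :0 :* b := :0) refl _ _)
        g-1 : g (F.- F.1#) ≡ χ (D ⁻) x
        g-1 = cong (χ (D ⁻)) (F.solve 1 (λ x → (F.:- F.:1) F.:* (F.:- F.:1 F.:+ F.:1) F.:- x F.:* (F.:- F.:1) F.:= x) refl x)
        off : ∀ p → ¬ (p ≡ F.- F.1#) → f p ≡ g p
        off p p≢-1 = trans (cong (λ w → χ A w * χ (A ⁻) (p F.+ F.1#) * g p)
            (F.solve 1 (λ p → p F.:- (F.:- F.:1) F.:= p F.:+ F.:1) refl p))
          (trans (cong (_* g p) (χ-⁻ʳ A p+1≢0)) (K.*-identityˡ _))
          where
          p+1≢0 : ¬ (p F.+ F.1# ≡ F.0#)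
          p+1≢0 e = p≢-1 (F.mod F.1# e (F.solve 1 (λ z → z F.:= F.:- F.:1 F.:+ F.:1 F.:* (z F.:+ F.:1 F.:- F.:0)) refl p))

      V : K.Carrier
      V = Σ (λ z → Σ (I′ z))

      -- The two exceptional values at z = -1 both contain D̄(x), which cancels, so the correction
      -- does not depend on x.
      ΣΣI : ¬ (F.1# F.+ x ≡ F.0#) → Σ (λ z → Σ (I z)) ≡ V - Σ (χ (D ⁻))
      ΣΣI 1+x≢0 = begin
        Σ (λ z → Σ (I z))                                         ≡⟨ Σ-change (F.- F.1#) ΣI≡ΣI′ ⟩
        V - Σ (I′ (F.- F.1#)) + Σ (I (F.- F.1#))                  ≡⟨ cong₂ (λ r s → V - r + s) (ΣI′-1 1+x≢0) ΣI-1 ⟩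
        V - (Σ (χ (D ⁻)) - χ (D ⁻) x) + - χ (D ⁻) x
          ≡⟨ solve 3 (λ v e d → v :- (e :- d) :+ (:- d) := v :- e) refl V (Σ (χ (D ⁻))) (χ (D ⁻) x) ⟩
        V - Σ (χ (D ⁻))                                           ∎

      W : K.Carrier
      W = Σ (λ y → χ A y * χ D (F.1# F.- y) * Σ (λ u → χ (D ⁻) (u F.* u F.- Δ y)))

      W≡ : ¬ (F.1# F.+ x ≡ F.0#) → W ≡ ω * (V - Σ (χ (D ⁻)))
      W≡ 1+x≢0 = begin
        W                                               ≡⟨ Σ-cong row ⟩
        Σ (λ y → Σ (λ z → ω * I z y))           ≡⟨ Σ-swap _ ⟩
        Σ (λ z → Σ (λ y → ω * I z y))           ≡⟨ Σ-cong (λ z → Σ-*ˡ ω (I z)) ⟩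
        Σ (λ z → ω * Σ (I z))                   ≡⟨ Σ-*ˡ ω _ ⟩
        ω * Σ (λ z → Σ (I z))                   ≡⟨ cong (ω *_) (ΣΣI 1+x≢0) ⟩
        ω * (V - Σ (χ (D ⁻)))                   ∎
        where
        row : ∀ y → χ A y * χ D (F.1# F.- y) * Σ (λ u → χ (D ⁻) (u F.* u F.- Δ y)) ≡ Σ (λ z → ω * I z y)
        row y = begin
          c * Σ k                                              ≡⟨ cong (c *_) (Σ-translate (F.1# F.- x) k) ⟨
          c * Σ (λ w → k (w F.+ (F.1# F.- x)))                 ≡⟨ cong (c *_) (Σ-scale F.2≢0 _) ⟨
          c * Σ (λ z → k (F.2# F.* z F.+ (F.1# F.- x)))        ≡⟨ Σ-*ˡ c _ ⟨
          Σ (λ z → c * k (F.2# F.* z F.+ (F.1# F.- x)))        ≡⟨ Σ-cong (λ z → trans (cong (c *_) (trans (cong (χ (D ⁻))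
            (F.solve 3 (λ x y z → (F.:2 F.:* z F.:+ (F.:1 F.:- x)) F.:* (F.:2 F.:* z F.:+ (F.:1 F.:- x)) F.:-
                 ((F.:1 F.:- x) F.:* (F.:1 F.:- x) F.:+ F.:4 F.:* x F.:* y) F.:=
               F.:4 F.:* (z F.:* (z F.:+ F.:1 F.:- x) F.:- x F.:* y)) refl x y z)) (χmul (D ⁻) F.4# (M z y))))
             (solve 3 (λ c a m → c :* (a :* m) := a :* (c :* m)) refl c ω (χ (D ⁻) (M z y)))) ⟩
          Σ (λ z → ω * I z y)                          ∎
          where
          c = χ A y * χ D (F.1# F.- y)
          k : Fn
          k u = χ (D ⁻) (u F.* u F.- Δ y)

      Q : F.Carrier → F.Carrier
      Q y = (F.1# F.- y) F.* (F.1# F.- x F.* y)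

      P S : K.Carrier
      P = Σ (λ y → χ (D ⊗ D) y * χ (B ⁻) (Q y))
      S = Σ (λ y → χ A y * χ D (F.1# F.- y) * χ (Φ ⊗ D ⁻) (Δ y))

      -- The δ coefficient in the convolution of A and D̄, whose product is B̄; it vanishes unless B
      -- is trivial.
      γ : K.Carrier
      γ = χ (D ⁻) (F.- F.1#) * Σ (χ (B ⁻))

      -- In `W` the constant term of `Σ-D⁻[u²-r]` is weighted by J(A,D), and `ΣD⁻*J` reduces the
      -- product to minus the sum of D̄.
      κS≡W+ΣD⁻ : κ * S ≡ W + Σ (χ (D ⁻))
      κS≡W+ΣD⁻ = sym (begin
        W + E                  ≡⟨ cong (_+ E) (Σ-cong (λ y → trans (cong (χ A y * χ D (F.1# F.- y) *_) (Σ-D⁻[u²-r] (Δ y)))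
            (solve 4 (λ c e k p → c :* (e :+ k :* p) := e :* c :+ k :* (c :* p)) refl (χ A y * χ D (F.1# F.- y)) E κ
                (χ (Φ ⊗ D ⁻) (Δ y))))) ⟩
        Σ (λ y → E * (χ A y * χ D (F.1# F.- y)) + κ * (χ A y * χ D (F.1# F.- y) * χ (Φ ⊗ D ⁻) (Δ y))) + E
          ≡⟨ cong (_+ E) (trans (Σ-+ _ _) (cong₂ _+_ (trans (Σ-*ˡ E _) ΣD⁻*J) (Σ-*ˡ κ _))) ⟩
        - E + κ * S + E        ≡⟨ solve 2 (λ e s → :- e :+ s :+ e := s) refl E (κ * S) ⟩
        κ * S                  ∎)
        where E = Σ (χ (D ⁻))

      V≡ : V ≡ J (χ A) (χ (D ⁻)) * P + γ * Σ (λ y → χ (A ⊗ D) y * δ (Q y))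
      V≡ = begin
        V                                ≡⟨ Σ-swap I′ ⟩
        Σ (λ p → Σ (λ z → I′ z p))       ≡⟨ Σ-reindex (λ p → p F.+ F.1#) (λ y → y) (λ p → (p F.+ F.1#) F.⁻¹)
            (λ y → y F.⁻¹ F.- F.1#)
            f0 (λ { y refl → g0 }) toʳ toˡ ⟩
        Σ g                              ≡⟨ trans (Σ-+ _ _) (cong₂ _+_ (Σ-*ˡ j _) (Σ-*ˡ γ _)) ⟩
        j * P + γ * Σ (λ y → χ (A ⊗ D) y * δ (Q y))   ∎
        where
        j = J (χ A) (χ (D ⁻))
        f g : Fn
        f p = Σ (λ z → I′ z p)
        g y = j * (χ (D ⊗ D) y * χ (B ⁻) (Q y)) + γ * (χ (A ⊗ D) y * δ (Q y))
        f0 : ∀ p → p F.+ F.1# ≡ F.0# → f p ≡ 0#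
        f0 p e = Σ-0 (λ z → trans (cong (λ w → χ A (p F.- z) * w * χ (D ⁻) (L z p)) (trans (cong (χ (A ⁻)) e) (χ0 (A ⁻))))
          (solve 2 (λ a b → a :* :0 :* b := :0) refl _ _))
        g0 : g F.0# ≡ 0#
        g0 = trans (cong₂ (λ y z → j * (y * χ (B ⁻) (Q F.0#)) + γ * (z * δ (Q F.0#))) (χ0 (D ⊗ D)) (χ0 (A ⊗ D)))
          (solve 4 (λ a b c d → a :* (:0 :* b) :+ c :* (:0 :* d) := :0) refl _ _ _ _)
        toˡ : ∀ y → ¬ (y ≡ F.0#) → ¬ (y F.⁻¹ F.- F.1# F.+ F.1# ≡ F.0#) × (y F.⁻¹ F.- F.1# F.+ F.1#) F.⁻¹ ≡ y
        toˡ y y≢0 = (λ e → F.⁻¹-≢0 y≢0 (trans (sym simp) e)) , trans (cong F._⁻¹ simp) (F.⁻¹-unique (F.inverseˡ y≢0))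
          where
          simp : y F.⁻¹ F.- F.1# F.+ F.1# ≡ y F.⁻¹
          simp = F.solve 1 (λ i → i F.:- F.:1 F.:+ F.:1 F.:= i) refl (y F.⁻¹)
        toʳ : ∀ p → ¬ (p F.+ F.1# ≡ F.0#) → ¬ ((p F.+ F.1#) F.⁻¹ ≡ F.0#) ×
            (p F.+ F.1#) F.⁻¹ F.⁻¹ F.- F.1# ≡ p × f p ≡ g ((p F.+ F.1#) F.⁻¹)
        toʳ p t≢0 = F.⁻¹-≢0 t≢0
          , trans (cong (F._- F.1#) (F.⁻¹-unique (F.inverseˡ t≢0))) (F.solve 1 (λ p → p F.:+ F.:1 F.:- F.:1 F.:= p) refl p)
          , (begin
          f p                                             ≡⟨ Σ-reflect p (λ z → I′ z p) ⟨
          Σ (λ m → I′ (p F.- m) p)                        ≡⟨ Σ-cong inner ⟩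
          Σ (λ m → χ A y * χ D y * (χ A m * χ (D ⁻) (R F.- m)))     ≡⟨ Σ-*ˡ _ _ ⟩
          χ A y * χ D y * Σ (λ m → χ A m * χ (D ⁻) (R F.- m))       ≡⟨ cong (χ A y * χ D y *_) (Σ-convolution A (D ⁻) R) ⟩
          χ A y * χ D y * (χ (A ⊗ D ⁻) R * j + δ R * (χ (D ⁻) (F.- F.1#) * Σ (χ (A ⊗ D ⁻))))
            ≡⟨ cong (λ w → χ A y * χ D y * w) (cong₂ _+_ (cong (_* j) AD⁻R)
                (cong₂ (λ a b → a * (χ (D ⁻) (F.- F.1#) * b)) (δ-* (Q y) t≢0) (Σ-cong AD⁻≡B⁻))) ⟩
          χ A y * χ D y * (χ (B ⁻) (Q y) * χ B y * j + δ (Q y) * γ)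
            ≡⟨ K.mod (χ D y * χ D y * χ (B ⁻) (Q y) * j) (χ-⁻ʳ B (F.⁻¹-≢0 t≢0))
              (solve 7 (λ b b⁻ d q j δ γ → d :* b⁻ :* d :* (q :* b :* j :+ δ :* γ) :=
                j :* (d :* d :* q) :+ γ :* (d :* b⁻ :* d :* δ) :+ d :* d :* q :* j :* (b :* b⁻ :- :1)) refl
                (χ B y) (χ (B ⁻) y) (χ D y) (χ (B ⁻) (Q y)) j (δ (Q y)) γ) ⟩
          g y                                             ∎)
          where
          t = p F.+ F.1#
          y = t F.⁻¹
          -- The root in m of `L (p F.- m) p`, namely p - x p/(p + 1), expressed through y = 1/(p +
          -- 1). The factor t becomes B(y) under B̄, which turns A(y) D(y) into D²(y).
          R = Q y F.* t
          AD⁻R : χ (A ⊗ D ⁻) R ≡ χ (B ⁻) (Q y) * χ B y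
          AD⁻R = trans (AD⁻≡B⁻ R) (trans (χmul (B ⁻) (Q y) t) (cong (χ (B ⁻) (Q y) *_) (sym (χ-⁻¹ B t))))
          inner : ∀ m → I′ (p F.- m) p ≡ χ A y * χ D y * (χ A m * χ (D ⁻) (R F.- m))
          inner m = begin
            χ A (p F.- (p F.- m)) * χ (A ⁻) t * χ (D ⁻) (L (p F.- m) p)
              ≡⟨ cong₂ (λ r s → χ A r * s * χ (D ⁻) (L (p F.- m) p))
                  (F.solve 2 (λ p m → p F.:- (p F.:- m) F.:= m) refl p m) (sym (χ-⁻¹ A t)) ⟩
            χ A m * χ A y * χ (D ⁻) (L (p F.- m) p)
              ≡⟨ cong (λ w → χ A m * χ A y * w) (trans (cong (χ (D ⁻)) L≡)
                  (trans (χmul (D ⁻) t _) (cong (_* χ (D ⁻) (R F.- m)) (sym (χ-⁻¹ D t))))) ⟩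
            χ A m * χ A y * (χ D y * χ (D ⁻) (R F.- m))
              ≡⟨ solve 4 (λ a b c d → a :* b :* (c :* d) := b :* c :* (a :* d)) refl (χ A m) (χ A y) (χ D y)
                  (χ (D ⁻) (R F.- m)) ⟩
            χ A y * χ D y * (χ A m * χ (D ⁻) (R F.- m))  ∎
            where
            L≡ : L (p F.- m) p ≡ t F.* (R F.- m)
            L≡ = F.mod (x F.* t F.+ t F.- x F.* (t F.* y F.+ F.1#)) (F.inverseʳ t t≢0)
              (F.solve 4 (λ x p m y → (p F.:- m) F.:* (p F.:+ F.:1) F.:- x F.:* p F.:=
                (p F.:+ F.:1) F.:* ((F.:1 F.:- y) F.:* (F.:1 F.:- x F.:* y) F.:* (p F.:+ F.:1) F.:- m) F.:+
                (x F.:* (p F.:+ F.:1) F.:+ (p F.:+ F.:1) F.:- x F.:* ((p F.:+ F.:1) F.:* y F.:+ F.:1)) F.:* ((p F.:+ F.:1) F.:* y F.:- F.:1)) refl x p m y)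

    -- As D ≠ φ, the square D² is trivial only if D is; `Σ-square` turns this into an equality of
    -- sums.
    ΣD²≡ΣD : Σ (χ (D ⊗ D)) ≡ Σ (χ D)
    ΣD²≡ΣD = begin
      Σ (χ (D ⊗ D))                 ≡⟨ Σ-cong (λ u → sym (χmul D u u)) ⟩
      Σ (λ u → χ D (u F.* u))       ≡⟨ Σ-square (χ D) ⟩
      Σ (χ D) + Σ (χ (Φ ⊗ D))       ≡⟨ cong (Σ (χ D) +_) ΣΦD≡0 ⟩
      Σ (χ D) + 0#                  ≡⟨ K.+-identityʳ _ ⟩
      Σ (χ D)                       ∎

    -- B ≠ D prevents B and D from both being trivial, hence also B and D².
    ΣB⁻*ΣD²≡0 : Σ (χ (B ⁻)) * Σ (χ (D ⊗ D)) ≡ 0#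
    ΣB⁻*ΣD²≡0 = begin
      Σ (χ (B ⁻)) * Σ (χ (D ⊗ D))     ≡⟨ cong (Σ (χ (B ⁻)) *_) ΣD²≡ΣD ⟩
      Σ (χ (B ⁻)) * Σ (χ D)           ≡⟨ Σχ*Σχ (B ⁻) D ⟨
      Σ (χ (B ⁻)) * Σ (χ (B ⁻ ⊗ D))   ≡⟨ cong (Σ (χ (B ⁻)) *_) (trans (Σ-cong (λ y → K.*-comm _ _)) ΣDB⁻≡0) ⟩
      Σ (χ (B ⁻)) * 0#                ≡⟨ K.zeroʳ _ ⟩
      0#                              ∎

    module _ (x : F.Carrier) where

      -- The zeros of Q only contribute when B is trivial; then they are what is missing from P.
      ΣB⁻*δQ : Σ (χ (B ⁻)) * Σ (λ y → χ (A ⊗ D) y * δ (Q x y)) ≡ - (Σ (χ (B ⁻)) * P x)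
      ΣB⁻*δQ = K.mod 1# sum≡0 (solve 2 (λ a b → a := :- b :+ :1 :* (b :+ a :- :0)) refl _ _)
        where
        β = Σ (χ (B ⁻))
        f g : Fn
        f y = χ (D ⊗ D) y * χ (B ⁻) (Q x y)
        g y = χ (A ⊗ D) y * δ (Q x y)
        β*AD : ∀ y → β * χ (A ⊗ D) y ≡ β * χ (D ⊗ D) y
        β*AD y with y F.≟ F.0#
        ... | yes refl = cong (β *_) (trans (χ0 (A ⊗ D)) (sym (χ0 (D ⊗ D))))
        ... | no y≢0   = trans (solve 3 (λ β d b → β :* (d :* b :* d) := β :* b :* (d :* d)) refl β (χ D y) (χ (B ⁻) y))
          (cong (_* χ (D ⊗ D) y) (absorb (B ⁻) y≢0))
        -- Behind the factor β, B̄(Q) + δ(Q) acts as the constant 1, and A D = D² B̄ acts as D². So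
        -- `f y + g y` acts as D²(y), whose sum β annihilates.
        pointwise : ∀ y → Dec (Q x y ≡ F.0#) → β * (f y + g y) ≡ β * χ (D ⊗ D) y
        pointwise y (yes Q≡0) = trans (cong₂ (λ r s → β * (χ (D ⊗ D) y * r + χ (A ⊗ D) y * s))
            (trans (cong (χ (B ⁻)) Q≡0) (χ0 (B ⁻))) (δ-0 Q≡0))
          (trans (solve 3 (λ β a b → β :* (b :* :0 :+ a :* :1) := β :* a) refl β (χ (A ⊗ D) y) (χ (D ⊗ D) y)) (β*AD y))
        pointwise y (no Q≢0) = trans (cong (λ s → β * (f y + χ (A ⊗ D) y * s)) (δ-≢0 Q≢0))
          (trans (solve 4 (λ β a b c → β :* (b :* c :+ a :* :0) := β :* c :* b) refl β (χ (A ⊗ D) y) (χ (D ⊗ D) y)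
              (χ (B ⁻) (Q x y)))
          (cong (_* χ (D ⊗ D) y) (absorb (B ⁻) Q≢0)))
        sum≡0 : β * P x + β * Σ g ≡ 0#
        sum≡0 = begin
          β * P x + β * Σ g               ≡⟨ K.distribˡ β (P x) (Σ g) ⟨
          β * (P x + Σ g)                 ≡⟨ cong (β *_) (Σ-+ f g) ⟨
          β * Σ (λ y → f y + g y)         ≡⟨ Σ-*ˡ β _ ⟨
          Σ (λ y → β * (f y + g y))       ≡⟨ Σ-cong (λ y → pointwise y (Q x y F.≟ F.0#)) ⟩
          Σ (λ y → β * χ (D ⊗ D) y)       ≡⟨ Σ-*ˡ β _ ⟩
          β * Σ (χ (D ⊗ D))               ≡⟨ ΣB⁻*ΣD²≡0 ⟩
          0#                              ∎

    -- The subtracted term is the δ contribution in `V≡`, which `ΣB⁻*δQ` shows to be a multiple of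
    -- `P x` too.
    G : K.Carrier
    G = ω * (J (χ A) (χ (D ⁻)) - χ (D ⁻) (F.- F.1#) * Σ (χ (B ⁻)))

    κS≡GP : ∀ x → ¬ (F.1# F.+ x ≡ F.0#) → κ * S x ≡ G * P x
    κS≡GP x 1+x≢0 = begin
      κ * S x                             ≡⟨ κS≡W+ΣD⁻ x ⟩
      W x + E                             ≡⟨ cong (_+ E) (W≡ x 1+x≢0) ⟩
      -- The two corrections by E come from different sources and only one carries ω; since E
      -- absorbs the value D̄(4), they cancel.
      ω * (V x - E) + E           ≡⟨ cong (λ e → ω * (V x - E) + e) (absorb (D ⁻) F.4≢0) ⟨
      ω * (V x - E) + E * ω
          ≡⟨ solve 3 (λ k v e → k :* (v :- e) :+ e :* k := k :* v) refl ω (V x) E ⟩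
      ω * V x                     ≡⟨ cong (ω *_) (V≡ x) ⟩
      ω * (j * P x + s * β * T)   ≡⟨ K.mod (ω * s) (ΣB⁻*δQ x)
          (solve 6 (λ k j p s β t → k :* (j :* p :+ s :* β :* t) := k :* (j :- s :* β) :* p :+ k :* s :* (β :* t :- (:- (β :* p)))) refl ω j (P x) s β T) ⟩
      G * P x                             ∎
      where
      E = Σ (χ (D ⁻))
      β = Σ (χ (B ⁻))
      j = J (χ A) (χ (D ⁻))
      s = χ (D ⁻) (F.- F.1#)
      T = Σ (λ y → χ (A ⊗ D) y * δ (Q x y))

    -- The constants κ and G need not be evaluated: comparing with x = 0 eliminates them.
    S*J≡J*P : ∀ x → ¬ (F.1# F.+ x ≡ F.0#) → S x * J (χ (D ⊗ D)) (χ (B ⁻)) ≡ J (χ A) (χ D) * P x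
    S*J≡J*P x 1+x≢0 = K.*-cancelˡ κ≢0 (begin
      κ * (S x * Jc)        ≡⟨ K.*-assoc _ _ _ ⟨
      κ * S x * Jc          ≡⟨ cong (_* Jc) (κS≡GP x 1+x≢0) ⟩
      G * P x * Jc          ≡⟨ solve 3 (λ g p j → g :* p :* j := g :* j :* p) refl G (P x) Jc ⟩
      G * Jc * P x          ≡⟨ cong (_* P x) at-0 ⟨
      κ * Ja * P x          ≡⟨ K.*-assoc _ _ _ ⟩
      κ * (Ja * P x)        ∎)
      where
      Ja = J (χ A) (χ D)
      Jc = J (χ (D ⊗ D)) (χ (B ⁻))
      κ≢0 : ¬ (κ ≡ 0#)
      κ≢0 = K.*-≢0 (χ-≢0 (D ⁻) F.-1≢0) (J≢0 Φ (D ⁻))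
      S0 : S F.0# ≡ Ja
      S0 = Σ-cong (λ y → trans (cong (χ A y * χ D (F.1# F.- y) *_) (trans (cong (χ (Φ ⊗ D ⁻)) (F.solve 1 (λ y →
        (F.:1 F.:- F.:0) F.:* (F.:1 F.:- F.:0) F.:+ F.:4 F.:* F.:0 F.:* y F.:= F.:1) refl y)) (χ1 (Φ ⊗ D ⁻))))
            (K.*-identityʳ _))
      P0 : P F.0# ≡ Jc
      P0 = Σ-cong (λ y → cong (λ w → χ (D ⊗ D) y * χ (B ⁻) w)
        (F.solve 1 (λ y → (F.:1 F.:- y) F.:* (F.:1 F.:- F.:0 F.:* y) F.:= F.:1 F.:- y) refl y))
      at-0 : κ * Ja ≡ G * Jc
      at-0 = trans (cong (κ *_) (sym S0)) (trans (κS≡GP F.0# (λ e → F.1≢0 (trans (sym (F.+-identityʳ _)) e)))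
          (cong (G *_) P0))

    -- Jacobi sum identities behind the case x = -1

    private
      b d c : Fn
      b = χ B
      d = χ D
      c = d · d
      Ja Jc : K.Carrier
      Ja = J d (χ A)
      Jc = J c (conj b)

    -- From 4 t (1 - t) = 1 - (2 t - 1)²; this is the finite field analogue of the duplication
    -- formula for the beta function.
    4J[D,D] : d F.4# * J d d ≡ Σ d + J φ d
    4J[D,D] = begin
      d F.4# * J d d                                       ≡⟨ Σ-*ˡ _ _ ⟨
      Σ (λ t → d F.4# * (d t * d (F.1# F.- t)))            ≡⟨ Σ-cong (λ t → trans (cong (d F.4# *_) (sym (χmul D _ _)))
          (trans (sym (χmul D _ _)) (cong d (F.solve 1 (λ t → F.:4 F.:* (t F.:* (F.:1 F.:- t)) F.:=
            F.:1 F.:- (F.:2 F.:* t F.:+ F.:- F.:1) F.:* (F.:2 F.:* t F.:+ F.:- F.:1)) refl t)))) ⟩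
      Σ (λ t → k (F.2# F.* t F.+ F.- F.1#))                ≡⟨ Σ-scale F.2≢0 (λ w → k (w F.+ F.- F.1#)) ⟩
      Σ (λ w → k (w F.+ F.- F.1#))                         ≡⟨ Σ-translate (F.- F.1#) k ⟩
      Σ (λ u → d (F.1# F.- u F.* u))                       ≡⟨ Σ-square (λ s → d (F.1# F.- s)) ⟩
      Σ (λ s → d (F.1# F.- s)) + J φ d                     ≡⟨ cong (_+ J φ d) (Σ-reflect F.1# d) ⟩
      Σ d + J φ d                                          ∎
      where
      k : Fn
      k u = d (F.1# F.- u F.* u)

    -- Both sides are the sum of d(u) d(v) b̄(w) over u + v + w = 1.
    J-assoc : J d d * Jc + Σ d ≡ J d (conj b) * Ja
    J-assoc = begin
      -- `Σ d` is put in the shape of the δ term of the convolution of D with itself, D(-1) times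
      -- the sum of D². This is the contribution of u + v = 0.
      J d d * Jc + Σ d      ≡⟨ cong (J d d * Jc +_) (trans (sym (absorb D F.-1≢0)) (K.*-comm _ _)) ⟩
      J d d * Jc + d (F.- F.1#) * Σ d   ≡⟨ cong (λ w → J d d * Jc + d (F.- F.1#) * w) ΣD²≡ΣD ⟨
      J d d * Jc + d (F.- F.1#) * Σ c   ≡⟨ cong (J d d * Jc +_) (sym (Σ-single F.0# _)) ⟩
      J d d * Jc + Σ (λ s → if does (s F.≟ F.0#) then d (F.- F.1#) * Σ c else 0#)
        ≡⟨ cong₂ _+_ (sym (Σ-*ˡ (J d d) _)) (Σ-cong at-0) ⟩
      Σ (λ s → J d d * (c s * conj b (F.1# F.- s))) + Σ (λ s → δ s * (d (F.- F.1#) * Σ c) * conj b (F.1# F.- s))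
        ≡⟨ Σ-+ _ _ ⟨
      Σ (λ s → J d d * (c s * conj b (F.1# F.- s)) + δ s * (d (F.- F.1#) * Σ c) * conj b (F.1# F.- s))
        ≡⟨ Σ-cong (λ s → trans (solve 4 (λ j c e b → j :* (c :* b) :+ e :* b := b :* (c :* j :+ e)) refl (J d d) (c s)
            (δ s * (d (F.- F.1#) * Σ c)) (conj b (F.1# F.- s)))
             (cong (conj b (F.1# F.- s) *_) (sym (Σ-convolution D D s)))) ⟩
      Σ (λ s → conj b (F.1# F.- s) * Σ (λ u → d u * d (s F.- u)))      ≡⟨ Σ-cong (λ s → sym (Σ-*ˡ _ _)) ⟩
      Σ (λ s → Σ (λ u → conj b (F.1# F.- s) * (d u * d (s F.- u))))    ≡⟨ Σ-swap _ ⟩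
      Σ (λ u → Σ (λ s → conj b (F.1# F.- s) * (d u * d (s F.- u))))    ≡⟨ Σ-cong row ⟩
      Σ (λ u → J d (conj b) * (d u * χ A (F.1# F.- u)))                ≡⟨ Σ-*ˡ _ _ ⟩
      J d (conj b) * Ja     ∎
      where
      at-0 : ∀ s → (if does (s F.≟ F.0#) then d (F.- F.1#) * Σ c else 0#) ≡ δ s * (d (F.- F.1#) * Σ c) * conj b (F.1# F.- s)
      at-0 s with s F.≟ F.0#
      ... | yes refl = sym (trans (cong (1# * (d (F.- F.1#) * Σ c) *_)
              (trans (cong (conj b) (F.solve 0 (F.:1 F.:- F.:0 F.:= F.:1) refl)) (χ1 (B ⁻))))
            (solve 1 (λ z → :1 :* z :* :1 := z) refl (d (F.- F.1#) * Σ c)))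
      ... | no _     = solve 2 (λ z w → :0 := :0 :* z :* w) refl (d (F.- F.1#) * Σ c) (conj b (F.1# F.- s))
      row : ∀ u → Σ (λ s → conj b (F.1# F.- s) * (d u * d (s F.- u))) ≡ J d (conj b) * (d u * χ A (F.1# F.- u))
      row u = begin
        Σ (λ s → conj b (F.1# F.- s) * (d u * d (s F.- u)))      ≡⟨ Σ-reflect F.1# _ ⟨
        Σ (λ w → conj b (F.1# F.- (F.1# F.- w)) * (d u * d (F.1# F.- w F.- u)))
          ≡⟨ Σ-cong (λ w → trans (cong₂ (λ r s → conj b r * (d u * d s))
               (F.solve 1 (λ w → F.:1 F.:- (F.:1 F.:- w) F.:= w) refl w)
               (F.solve 2 (λ u w → F.:1 F.:- w F.:- u F.:= F.:1 F.:- u F.:- w) refl u w))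
             (solve 3 (λ a b c → a :* (b :* c) := b :* (c :* a)) refl (conj b w) (d u) (d (F.1# F.- u F.- w)))) ⟩
        Σ (λ w → d u * (d (F.1# F.- u F.- w) * conj b w))        ≡⟨ Σ-*ˡ _ _ ⟩
        d u * Σ (λ w → d (F.1# F.- u F.- w) * conj b w)
          -- In the other order of summation no δ term arises, because the sum of D B̄ vanishes.
          ≡⟨ cong (d u *_) (trans (Σ-cong (λ w → K.*-comm _ _))
              (Σ-convolution₀ (B ⁻) D (trans (Σ-cong (λ w → K.*-comm _ _)) ΣDB⁻≡0) (F.1# F.- u))) ⟩
        d u * (conj b (F.1# F.- u) * d (F.1# F.- u) * J (conj b) d)
          ≡⟨ cong (λ j → d u * (conj b (F.1# F.- u) * d (F.1# F.- u) * j)) (J-comm (conj b) d) ⟩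
        d u * (conj b (F.1# F.- u) * d (F.1# F.- u) * J d (conj b))
          ≡⟨ solve 4 (λ u b d j → u :* (b :* d :* j) := j :* (u :* (d :* b))) refl (d u) (conj b (F.1# F.- u))
              (d (F.1# F.- u)) (J d (conj b)) ⟩
        J d (conj b) * (d u * χ A (F.1# F.- u))  ∎

    -- Either `Σ d` vanishes, or D is trivial and J(C,B̄) is the vanishing sum of B̄(1 - y) without
    -- its term at y = 0.
    ΣD*Jc : Σ d * Jc ≡ - Σ d
    ΣD*Jc = begin
      Σ d * Jc                ≡⟨ Σ-*ˡ _ _ ⟨
      Σ f                     ≡⟨ Σ-change F.0# f≡g ⟩
      Σ g - g F.0# + f F.0#   ≡⟨ cong₂ _+_ (cong₂ _-_ Σg g0) f0 ⟩
      0# - Σ d + 0#           ≡⟨ solve 1 (λ z → :0 :- z :+ :0 := :- z) refl (Σ d) ⟩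
      - Σ d                   ∎
      where
      f g : Fn
      f y = Σ d * (c y * conj b (F.1# F.- y))
      g y = Σ d * conj b (F.1# F.- y)
      f≡g : ∀ y → ¬ (y ≡ F.0#) → f y ≡ g y
      f≡g y y≢0 = trans (solve 3 (λ s d b → s :* (d :* d :* b) := s :* d :* d :* b) refl (Σ d) (d y) (conj b (F.1# F.- y)))
        (cong (_* conj b (F.1# F.- y)) (trans (cong (_* d y) (absorb D y≢0)) (absorb D y≢0)))
      f0 : f F.0# ≡ 0#
      f0 = trans (cong (λ z → Σ d * (z * conj b (F.1# F.- F.0#))) (χ0 (D ⊗ D)))
          (solve 2 (λ a b → a :* (:0 :* b) := :0) refl _ _)
      g0 : g F.0# ≡ Σ d
      g0 = trans (cong (Σ d *_) (trans (cong (conj b) (F.solve 0 (F.:1 F.:- F.:0 F.:= F.:1) refl)) (χ1 (B ⁻))))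
          (K.*-identityʳ _)
      Σg : Σ g ≡ 0#
      Σg = begin
        Σ g                      ≡⟨ Σ-*ˡ _ _ ⟩
        Σ d * Σ (λ y → conj b (F.1# F.- y))   ≡⟨ cong (Σ d *_) (Σ-reflect F.1# (conj b)) ⟩
        Σ d * Σ (conj b)         ≡⟨ Σχ*Σχ D (B ⁻) ⟨
        Σ d * Σ (χ A)            ≡⟨ cong (Σ d *_) ΣDB⁻≡0 ⟩
        Σ d * 0#                 ≡⟨ K.zeroʳ _ ⟩
        0#                       ∎

    -- C̄(2) = D̄(4) cancels the factor in the duplication formula, and `ΣD*Jc` turns the leftover
    -- multiple of `Σ d` into exactly the correction present in `J-assoc`.
    J-at-[-1] : conj c F.2# * J φ d * Jc ≡ J d (conj b) * Ja
    J-at-[-1] = begin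
      c⁻ * J φ d * Jc                       ≡⟨ K.mod (c⁻ * Jc) (sym 4J[D,D])
          (solve 5 (λ c j s k e → c :* j :* k := c :* (e :- s) :* k :+ c :* k :* (s :+ j :- e)) refl c⁻ (J φ d)
              (Σ d) Jc (d F.4# * J d d)) ⟩
      c⁻ * (d F.4# * J d d - Σ d) * Jc      ≡⟨ solve 5
          (λ c d j s k → c :* (d :* j :- s) :* k := c :* d :* j :* k :- c :* (s :* k)) refl c⁻ (d F.4#) (J d d) (Σ d) Jc ⟩
      c⁻ * d F.4# * J d d * Jc - c⁻ * (Σ d * Jc)
        ≡⟨ cong₂ (λ r s → r * J d d * Jc - c⁻ * s) c⁻d (trans ΣD*Jc (cong -_ (sym (absorb D F.4≢0)))) ⟩
      1# * J d d * Jc - c⁻ * - (Σ d * d F.4#)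
        ≡⟨ K.mod (Σ d) c⁻d (solve 5 (λ c d j s k → :1 :* j :* k :- c :* (:-
            (s :* d)) := j :* k :+ s :+ s :* (c :* d :- :1)) refl c⁻ (d F.4#) (J d d) (Σ d) Jc) ⟩
      J d d * Jc + Σ d                      ≡⟨ J-assoc ⟩
      J d (conj b) * Ja                     ∎
      where
      c⁻ = conj c F.2#
      c⁻d : c⁻ * d F.4# ≡ 1#
      c⁻d = trans (cong (c⁻ *_) (χmul D F.2# F.2#)) (trans (K.*-comm _ _) (χ-⁻ʳ (D ⊗ D) F.2≢0))

    -- The hypergeometric functions in terms of `S`, `P` and Jacobi sums

    d⁻·c≡A : ∀ w → (conj d · (c · conj b)) w ≡ χ A w
    d⁻·c≡A = χ-ext (D ⁻ ⊗ (D ⊗ D ⊗ B ⁻)) A (λ w w≢0 → K.mod (χ A w) (χ-⁻ʳ D w≢0)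
      (solve 3 (λ d d⁻ b⁻ → d⁻ :* (d :* d :* b⁻) := d :* b⁻ :+ d :* b⁻ :* (d :* d⁻ :- :1)) refl (d w) (conj d w) (conj b w)))

    c⁻·c≡B⁻ : ∀ w → (conj c · (c · conj b)) w ≡ conj b w
    c⁻·c≡B⁻ = χ-ext ((D ⊗ D) ⁻ ⊗ (D ⊗ D ⊗ B ⁻)) (B ⁻) (λ w w≢0 → K.mod (conj b w) (χ-⁻ʳ (D ⊗ D) w≢0)
      (solve 3 (λ c c⁻ b⁻ → c⁻ :* (c :* b⁻) := b⁻ :+ b⁻ :* (c :* c⁻ :- :1)) refl (c w) (conj c w) (conj b w)))

    [DΦB⁻]⁻≡A⁻Φ : ∀ w → conj (d · (φ · conj b)) w ≡ χ (A ⁻ ⊗ Φ) w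
    [DΦB⁻]⁻≡A⁻Φ = χ-ext ((D ⊗ (Φ ⊗ B ⁻)) ⁻) (A ⁻ ⊗ Φ) (λ w w≢0 → K.⁻¹-unique (trans
      (solve 4 (λ d p b a → d :* (p :* b) :* (a :* p) := d :* b :* a :* (p :* p)) refl (d w) (φ w) (conj b w) (conj (χ A) w))
      (trans (cong₂ _*_ (χ-⁻ʳ A w≢0) (φ*φ≡1 w≢0)) (K.*-identityˡ 1#))))

    J-d≡ : J d (conj d · (c · conj b)) ≡ Ja
    J-d≡ = J-cong (λ _ → refl) d⁻·c≡A

    J-c≡ : J c (conj c · (c · conj b)) ≡ Jc
    J-c≡ = J-cong (λ _ → refl) c⁻·c≡B⁻

    -- The argument is a separate variable so that at x = -1 it can be replaced by 1 without
    -- touching the prefactor.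
    lhs : F.Carrier → F.Carrier → K.Carrier
    lhs x l = conj c (F.1# F.- x) * F21 (d · (φ · conj b)) d (c · conj b) l

    lhs≡ : ∀ x l → lhs x l ≡
      conj c (F.1# F.- x) * Σ (λ y → d y * χ A (F.1# F.- y) * χ (A ⁻ ⊗ Φ) (F.1# F.- l F.* y)) * Ja ⁻¹
    lhs≡ x l = trans (cong₂ (λ p j → conj c (F.1# F.- x) * (p * j ⁻¹))
        (Σ-cong (λ y → cong₂ (λ r s → d y * r * s) (d⁻·c≡A (F.1# F.- y)) ([DΦB⁻]⁻≡A⁻Φ (F.1# F.- l F.* y)))) J-d≡)
      (sym (K.*-assoc _ _ _))

    F21-right : ∀ x → F21 b c (c · conj b) x ≡ P x * Jc ⁻¹
    F21-right x = cong₂ (λ p j → p * j ⁻¹)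
      (Σ-cong (λ y → trans (cong (λ r → c y * r * conj b (F.1# F.- x F.* y)) (c⁻·c≡B⁻ (F.1# F.- y)))
        (trans (K.*-assoc _ _ _) (cong (c y *_) (sym (χmul (B ⁻) _ _)))))) J-c≡

    /-cross : ∀ {s p} → s * Jc ≡ p * Ja → s * Ja ⁻¹ ≡ p * Jc ⁻¹
    /-cross {s} {p} e = K./-unique (J≢0 D A) (sym (begin
      p * Jc ⁻¹ * Ja     ≡⟨ solve 3 (λ p i j → p :* i :* j := p :* j :* i) refl p (Jc ⁻¹) Ja ⟩
      p * Ja * Jc ⁻¹     ≡⟨ cong (_* Jc ⁻¹) e ⟨
      s * Jc * Jc ⁻¹     ≡⟨ K.*-assoc _ _ _ ⟩
      s * (Jc * Jc ⁻¹)   ≡⟨ cong (s *_) (K.inverseʳ Jc (J≢0 (D ⊗ D) (B ⁻))) ⟩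
      s * 1#             ≡⟨ K.*-identityʳ s ⟩
      s                  ∎))

    argument : F.Carrier → F.Carrier
    argument x = (F.- (F.fromℕ 4 F.* x)) F.* (((F.1# F.- x) F.* (F.1# F.- x)) F.⁻¹)

    rhs : F.Carrier → K.Carrier
    rhs x = F21 b c (c · conj b) x
      - δ (F.1# F.- x) * J c (conj b · conj b) * Jc ⁻¹
      - δ (F.1# F.+ x) * J (conj b) (d · φ) * Jc ⁻¹

    -- Taking E = Ā φ in `Σ-euler`, the prefactor becomes φ(1 - l) = 1 and the third character
    -- becomes φD̄. Moreover (φD̄)((1 - x)²) = C̄(1 - x), so the prefactor of `lhs` converts 1 - l y
    -- into `Δ x y`.
    generic : ∀ x → ¬ (F.1# F.- x ≡ F.0#) → ¬ (F.1# F.+ x ≡ F.0#) → lhs x (argument x) ≡ rhs x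
    generic x 1-x≢0 1+x≢0 = begin
      lhs x l                                   ≡⟨ lhs≡ x l ⟩
      conj c (F.1# F.- x) * Σ (λ y → d y * χ A (F.1# F.- y) * χ (A ⁻ ⊗ Φ) (F.1# F.- l F.* y)) * Ja ⁻¹
        ≡⟨ cong (_* Ja ⁻¹) (trans (cong (conj c (F.1# F.- x) *_) (Σ-euler A D (A ⁻ ⊗ Φ) 1-l≢0))
             (trans (sym (Σ-*ˡ _ _)) (Σ-cong term))) ⟩
      S x * Ja ⁻¹
          ≡⟨ /-cross (trans (S*J≡J*P x 1+x≢0) (trans (cong (_* P x) (J-comm (χ A) d)) (K.*-comm _ _))) ⟩
      P x * Jc ⁻¹                               ≡⟨ F21-right x ⟨
      F21 b c (c · conj b) x
          ≡⟨ solve 4 (λ f u v j → f := f :- :0 :* u :* j :- :0 :* v :* j) refl _ _ _ (Jc ⁻¹) ⟩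
      F21 b c (c · conj b) x - 0# * J c (conj b · conj b) * Jc ⁻¹ - 0# * J (conj b) (d · φ) * Jc ⁻¹
        ≡⟨ cong₂ (λ r s → F21 b c (c · conj b) x - r * J c (conj b · conj b) * Jc ⁻¹ - s * J (conj b) (d · φ) * Jc ⁻¹)
             (δ-≢0 1-x≢0) (δ-≢0 1+x≢0) ⟨
      rhs x                                     ∎
      where
      l = argument x
      N = (F.1# F.- x) F.* (F.1# F.- x)
      N≢0 : ¬ (N ≡ F.0#)
      N≢0 = F.*-≢0 1-x≢0 1-x≢0
      Nl : N F.* l ≡ F.- (F.4# F.* x)
      Nl = trans (cong (λ z → N F.* (F.- (z F.* x) F.* N F.⁻¹)) F.fromℕ-4) (F.mod (F.- (F.4# F.* x)) (F.inverseʳ N N≢0)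
        (F.solve 3 (λ n i a → n F.:* (a F.:* i) F.:= a F.:+ a F.:* (n F.:* i F.:- F.:1)) refl N (N F.⁻¹) (F.- (F.4# F.* x))))
      N[1-l] : N F.* (F.1# F.- l) ≡ (F.1# F.+ x) F.* (F.1# F.+ x)
      N[1-l] = F.mod (F.- F.1#) Nl (F.solve 2 (λ x l →
        ((F.:1 F.:- x) F.:* (F.:1 F.:- x)) F.:* (F.:1 F.:- l) F.:= (F.:1 F.:+ x) F.:* (F.:1 F.:+ x) F.:+
          (F.:- F.:1) F.:* (((F.:1 F.:- x) F.:* (F.:1 F.:- x)) F.:* l F.:- (F.:- (F.:4 F.:* x)))) refl x l)
      N[1-ly] : ∀ y → N F.* (F.1# F.- l F.* y) ≡ Δ x y
      N[1-ly] y = F.mod (F.- y) Nl (F.solve 3 (λ x l y →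
        ((F.:1 F.:- x) F.:* (F.:1 F.:- x)) F.:* (F.:1 F.:- l F.:* y) F.:= (F.:1 F.:- x) F.:* (F.:1 F.:- x) F.:+ F.:4 F.:* x F.:* y F.:+
          (F.:- y) F.:* (((F.:1 F.:- x) F.:* (F.:1 F.:- x)) F.:* l F.:- (F.:- (F.:4 F.:* x)))) refl x l y)
      1-l≢0 : ¬ (F.1# F.- l ≡ F.0#)
      1-l≢0 e = F.*-≢0 1+x≢0 1+x≢0 (trans (sym N[1-l]) (trans (cong (N F.*_) e) (F.zeroʳ N)))
      φ[1-l] : φ (F.1# F.- l) ≡ 1#
      φ[1-l] = trans (sym (φ-scale 1-x≢0 (F.1# F.- l))) (trans (cong φ N[1-l]) (φ-square 1+x≢0))
      DAA⁻Φ : ∀ w → χ ((D ⊗ A ⊗ (A ⁻ ⊗ Φ)) ⁻) w ≡ χ (Φ ⊗ D ⁻) w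
      DAA⁻Φ = χ-ext ((D ⊗ A ⊗ (A ⁻ ⊗ Φ)) ⁻) (Φ ⊗ D ⁻) (λ w w≢0 → K.⁻¹-unique (trans
        (solve 5 (λ d a a⁻ p d⁻ → d :* a :* (a⁻ :* p) :* (p :* d⁻) := d :* d⁻ :* (a :* a⁻) :* (p :* p)) refl
          (d w) (χ A w) (χ (A ⁻) w) (φ w) (conj d w))
        (trans (cong₂ _*_ (cong₂ _*_ (χ-⁻ʳ D w≢0) (χ-⁻ʳ A w≢0)) (φ*φ≡1 w≢0)) (solve 0 (:1 :* :1 :* :1 := :1) refl))))
      AA⁻Φ[1-l] : χ (A ⊗ (A ⁻ ⊗ Φ)) (F.1# F.- l) ≡ 1#
      AA⁻Φ[1-l] = trans (sym (K.*-assoc _ _ _)) (trans (cong₂ _*_ (χ-⁻ʳ A 1-l≢0) φ[1-l]) (K.*-identityˡ 1#))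
      ΦD⁻N : χ (Φ ⊗ D ⁻) N ≡ conj c (F.1# F.- x)
      ΦD⁻N = trans (cong₂ _*_ (φ-square 1-x≢0) (cong _⁻¹ (χmul D _ _))) (K.*-identityˡ _)
      term : ∀ y →
        conj c (F.1# F.- x) * (χ (A ⊗ (A ⁻ ⊗ Φ))
            (F.1# F.- l) * (χ A y * d (F.1# F.- y) * χ ((D ⊗ A ⊗ (A ⁻ ⊗ Φ)) ⁻) (F.1# F.- l F.* y)))
        ≡ χ A y * d (F.1# F.- y) * χ (Φ ⊗ D ⁻) (Δ x y)
      term y = begin
        conj c (F.1# F.- x) * (χ (A ⊗ (A ⁻ ⊗ Φ)) (F.1# F.- l) * (χ A y * d (F.1# F.- y) * χ ((D ⊗ A ⊗ (A ⁻ ⊗ Φ)) ⁻) w))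
          ≡⟨ cong₂ (λ r s → conj c (F.1# F.- x) * (r * (χ A y * d (F.1# F.- y) * s))) AA⁻Φ[1-l] (DAA⁻Φ w) ⟩
        conj c (F.1# F.- x) * (1# * (χ A y * d (F.1# F.- y) * χ (Φ ⊗ D ⁻) w))
          ≡⟨ solve 4 (λ n a d z → n :* (:1 :* (a :* d :* z)) := a :* d :* (n :* z)) refl (conj c (F.1# F.- x)) (χ A y)
              (d (F.1# F.- y)) (χ (Φ ⊗ D ⁻) w) ⟩
        χ A y * d (F.1# F.- y) * (conj c (F.1# F.- x) * χ (Φ ⊗ D ⁻) w)
          ≡⟨ cong (χ A y * d (F.1# F.- y) *_) (trans (cong (_* χ (Φ ⊗ D ⁻) w) (sym ΦD⁻N))
               (trans (sym (χmul (Φ ⊗ D ⁻) N w)) (cong (χ (Φ ⊗ D ⁻)) (N[1-ly] y)))) ⟩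
        χ A y * d (F.1# F.- y) * χ (Φ ⊗ D ⁻) (Δ x y)   ∎
        where w = F.1# F.- l F.* y

    -- The left side vanishes through C̄(0) = 0. On the right `Q` is (1 - y)², so `P` is J(C,B̄²)
    -- and is removed by the first δ term.
    at-1 : lhs F.1# (argument F.1#) ≡ rhs F.1#
    at-1 = begin
      lhs F.1# (argument F.1#)     ≡⟨ cong (_* F21 (d · (φ · conj b)) d (c · conj b) (argument F.1#))
                                        (trans (cong (conj c) 1-1≡0) (χ0 ((D ⊗ D) ⁻))) ⟩
      0# * F21 (d · (φ · conj b)) d (c · conj b) (argument F.1#)
        ≡⟨ solve 4 (λ p j f v → :0 :* f := p :* j :- :1 :* p :* j :- :0 :* v :* j) refl j₁ (Jc ⁻¹) _ (J (conj b) (d · φ)) ⟩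
      j₁ * Jc ⁻¹ - 1# * j₁ * Jc ⁻¹ - 0# * J (conj b) (d · φ) * Jc ⁻¹
        ≡⟨ cong (λ p → p * Jc ⁻¹ - 1# * j₁ * Jc ⁻¹ - 0# * J (conj b) (d · φ) * Jc ⁻¹) P1 ⟨
      P F.1# * Jc ⁻¹ - 1# * j₁ * Jc ⁻¹ - 0# * J (conj b) (d · φ) * Jc ⁻¹
        ≡⟨ cong (λ f → f - 1# * j₁ * Jc ⁻¹ - 0# * J (conj b) (d · φ) * Jc ⁻¹) (F21-right F.1#) ⟨
      F21 b c (c · conj b) F.1# - 1# * j₁ * Jc ⁻¹ - 0# * J (conj b) (d · φ) * Jc ⁻¹
        ≡⟨ cong₂ (λ r s → F21 b c (c · conj b) F.1# - r * j₁ * Jc ⁻¹ - s * J (conj b) (d · φ) * Jc ⁻¹) (δ-0 1-1≡0)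
            (δ-≢0 F.2≢0) ⟨
      rhs F.1#                     ∎
      where
      j₁ = J c (conj b · conj b)
      1-1≡0 : F.1# F.- F.1# ≡ F.0#
      1-1≡0 = F.-‿inverseʳ F.1#
      P1 : P F.1# ≡ j₁
      P1 = Σ-cong (λ y → cong (c y *_) (trans (cong (conj b) (cong (λ z → (F.1# F.- y) F.* (F.1# F.- z)) (F.*-identityˡ y)))
        (χmul (B ⁻) _ _)))

    -- With argument 1 the factors A and Ā cancel, leaving J(D,φ). On the right `Q` is 1 - y², so
    -- `Σ-square` splits `P` into two Jacobi sums, one of which is removed by the second δ term.
    at-[-1] : lhs (F.- F.1#) (argument (F.- F.1#)) ≡ rhs (F.- F.1#)
    at-[-1] = begin
      lhs (F.- F.1#) (argument (F.- F.1#))      ≡⟨ cong (lhs (F.- F.1#)) argument≡1 ⟩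
      lhs (F.- F.1#) F.1#                       ≡⟨ lhs≡ (F.- F.1#) F.1# ⟩
      conj c (F.1# F.- F.- F.1#) * Σ (λ y → d y * χ A (F.1# F.- y) * χ (A ⁻ ⊗ Φ) (F.1# F.- F.1# F.* y)) * Ja ⁻¹
        ≡⟨ cong₂ (λ w j → conj c w * j * Ja ⁻¹) 1-[-1]
            (trans (Σ-cong (λ y → collapse y ((F.1# F.- y) F.≟ F.0#))) (J-comm d φ)) ⟩
      conj c F.2# * J φ d * Ja ⁻¹               ≡⟨ /-cross J-at-[-1] ⟩
      J d (conj b) * Jc ⁻¹
        ≡⟨ solve 4 (λ j k i u → j :* i := (j :+ k) :* i :- :0 :* u :* i :- :1 :* k :* i) refl (J d (conj b)) j₂
            (Jc ⁻¹) (J c (conj b · conj b)) ⟩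
      (J d (conj b) + j₂) * Jc ⁻¹ - 0# * J c (conj b · conj b) * Jc ⁻¹ - 1# * j₂ * Jc ⁻¹
        ≡⟨ cong₂ (λ r s → (J d (conj b) + j₂) * Jc ⁻¹ - r * J c (conj b · conj b) * Jc ⁻¹ - s * j₂ * Jc ⁻¹)
             (δ-≢0 (λ e → F.2≢0 (trans (sym 1-[-1]) e))) (δ-0 (F.-‿inverseʳ F.1#)) ⟨
      (J d (conj b) + j₂) * Jc ⁻¹ - δ (F.1# F.- F.- F.1#) * J c (conj b · conj b) * Jc ⁻¹ - δ
          (F.1# F.+ F.- F.1#) * j₂ * Jc ⁻¹
        ≡⟨ cong (λ f → f - δ (F.1# F.- F.- F.1#) * J c (conj b · conj b) * Jc ⁻¹ - δ (F.1# F.+ F.- F.1#) * j₂ * Jc ⁻¹)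
             (trans (F21-right (F.- F.1#)) (cong (_* Jc ⁻¹) P-1)) ⟨
      rhs (F.- F.1#)                            ∎
      where
      j₂ = J (conj b) (d · φ)
      1-[-1] : F.1# F.- F.- F.1# ≡ F.2#
      1-[-1] = F.solve 0 (F.:1 F.:- (F.:- F.:1) F.:= F.:2) refl
      argument≡1 : argument (F.- F.1#) ≡ F.1#
      argument≡1 = trans (cong₂ (λ r s → r F.* (s F.* s) F.⁻¹)
          (trans (cong (λ z → F.- (z F.* F.- F.1#)) F.fromℕ-4)
              (F.solve 0 (F.:- (F.:4 F.:* (F.:- F.:1)) F.:= F.:4) refl)) 1-[-1])
        (F.inverseʳ F.4# F.4≢0)
      collapse : ∀ y → Dec (F.1# F.- y ≡ F.0#) →
        d y * χ A (F.1# F.- y) * χ (A ⁻ ⊗ Φ) (F.1# F.- F.1# F.* y) ≡ d y * φ (F.1# F.- y)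
      collapse y w≟0 = trans (cong (λ z → d y * χ A (F.1# F.- y) * χ (A ⁻ ⊗ Φ) (F.1# F.- z)) (F.*-identityˡ y)) (by-case w≟0)
        where
        w = F.1# F.- y
        by-case : Dec (w ≡ F.0#) → d y * χ A w * χ (A ⁻ ⊗ Φ) w ≡ d y * φ w
        by-case (yes w≡0) = trans (cong (d y * χ A w *_) (trans (cong (χ (A ⁻ ⊗ Φ)) w≡0) (χ0 (A ⁻ ⊗ Φ))))
          (trans (solve 2 (λ a b → a :* b :* :0 := a :* :0) refl (d y) (χ A w))
              (cong (d y *_) (sym (trans (cong φ w≡0) φ0))))
        by-case (no w≢0) = K.mod (d y * φ w) (χ-⁻ʳ A w≢0)
          (solve 4 (λ d a a⁻ p → d :* a :* (a⁻ :* p) := d :* p :+ d :* p :* (a :* a⁻ :- :1)) refl (d y) (χ A w)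
              (χ (A ⁻) w) (φ w))
      P-1 : P (F.- F.1#) ≡ J d (conj b) + j₂
      P-1 = begin
        P (F.- F.1#)      ≡⟨ Σ-cong (λ y → cong₂ _*_ (sym (χmul D y y)) (cong (conj b)
            (F.solve 1 (λ y → (F.:1 F.:- y) F.:* (F.:1 F.:- (F.:- F.:1) F.:* y) F.:= F.:1 F.:- y F.:* y) refl y))) ⟩
        Σ (λ y → k (y F.* y))      ≡⟨ Σ-square k ⟩
        J d (conj b) + Σ (φ · k)   ≡⟨ cong (J d (conj b) +_) (trans
            (Σ-cong (λ s → solve 3 (λ p d b → p :* (d :* b) := d :* p :* b) refl (φ s) (d s) (conj b (F.1# F.- s))))
            (J-comm (d · φ) (conj b))) ⟩
        J d (conj b) + j₂          ∎
        where
        k : Fn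
        k s = d s * conj b (F.1# F.- s)

    lhs≡rhs : ∀ x → lhs x (argument x) ≡ rhs x
    lhs≡rhs x = by-case ((F.1# F.- x) F.≟ F.0#) ((F.1# F.+ x) F.≟ F.0#)
      where
      by-case : Dec (F.1# F.- x ≡ F.0#) → Dec (F.1# F.+ x ≡ F.0#) → lhs x (argument x) ≡ rhs x
      by-case (yes 1-x≡0) _ = subst (λ x → lhs x (argument x) ≡ rhs x) (F.x-y≡0⇒x≡y 1-x≡0) at-1
      by-case (no _) (yes 1+x≡0) = subst (λ x → lhs x (argument x) ≡ rhs x) -1≡x at-[-1]
        where
        -1≡x : F.- F.1# ≡ x
        -1≡x = F.mod (F.- F.1#) 1+x≡0 (F.solve 1
            (λ x → F.:- F.:1 F.:= x F.:+ (F.:- F.:1) F.:* (F.:1 F.:+ x F.:- F.:0)) refl x)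
      by-case (no 1-x≢0) (no 1+x≢0) = generic x 1-x≢0 1+x≢0

-- From the hypotheses on B and D to vanishing character sums

theorem9p3 : (𝔽 : FiniteField) (K : Field) → CharZero K → AlgClosed K →
  FiniteField.card 𝔽 % 2 ≡ 1 →
  (B D : MultChar 𝔽 K) →
  let open CharSums 𝔽 K
      module F = FiniteField 𝔽
      module K = Field K
      b = MultChar.χ B
      d = MultChar.χ D
      c = d · d
  in ¬ (∀ x → d x ≡ φ x) → ¬ (∀ x → b x ≡ d x) →
  ∀ (x : F.Carrier) →
    conj c (F.1# F.- x) K.*
      F21 (d · (φ · conj b)) d (c · conj b)
          ((F.- (F.fromℕ 4 F.* x)) F.* (((F.1# F.- x) F.* (F.1# F.- x)) F.⁻¹))
    ≡ F21 b c (c · conj b) x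
      K.- δ (F.1# F.- x) K.* J c (conj b · conj b) K.* (J c (conj b)) K.⁻¹
      K.- δ (F.1# F.+ x) K.* J (conj b) (d · φ) K.* (J c (conj b)) K.⁻¹
theorem9p3 𝔽 K char0 _ odd B D d≢φ b≢d = lhs≡rhs
  where
  module F where
    open FiniteField 𝔽 public
    open FieldProperties field′ public
  module K where
    open Field K public
    open FieldProperties K public
  open K using (1#; _*_)
  open CharSums 𝔽 K using (Σ; φ)
  open CharacterSums 𝔽 K char0 odd
  open MultChar

  -- φ is its own inverse, so a trivial φD would force D = φ.
  φd-nontrivial : ¬ (∀ x → ¬ (x ≡ F.0#) → φ x * χ D x ≡ 1#)
  φd-nontrivial e = d≢φ (χ-ext D Φ (λ x x≢0 → trans (sym (K.⁻¹-unique (e x x≢0))) (φ⁻¹≡φ x)))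

  ΣΦD≡0 : Σ (χ (Φ ⊗ D)) ≡ K.0#
  ΣΦD≡0 = nontrivial⇒Σχ≡0 (Φ ⊗ D) φd-nontrivial

  ΣΦD⁻≡0 : Σ (χ (Φ ⊗ D ⁻)) ≡ K.0#
  ΣΦD⁻≡0 = nontrivial⇒Σχ≡0 (Φ ⊗ D ⁻) (λ e → φd-nontrivial (λ x x≢0 →
    trans (cong (_* χ D x) (trans (sym (φ⁻¹≡φ x)) (K.⁻¹-unique (e x x≢0)))) (trans (K.*-comm _ _) (χ-⁻ʳ D x≢0))))

  ΣDB⁻≡0 : Σ (χ (D ⊗ B ⁻)) ≡ K.0#
  ΣDB⁻≡0 = nontrivial⇒Σχ≡0 (D ⊗ B ⁻) (λ e → b≢d (χ-ext B D (λ x x≢0 →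
    K.*-cancelˡ (χ-≢0 (B ⁻) x≢0) (trans (K.*-comm _ _) (trans (χ-⁻ʳ B x≢0) (trans (sym (e x x≢0)) (K.*-comm _ _)))))))

  open Nondegenerate B D ΣDB⁻≡0 ΣΦD≡0 ΣΦD⁻≡0 using (lhs≡rhs)
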